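{- Let $k>1$ and $n\ge 1$ be integers and let $0\le m\le n$. If $\pi$ is chosen uniformly at random among the permutations of $S_{kn}$ having exactly $m$ cycles of length $k$, then \[ \mathbb{E}[\pi(1)\mid \pi\in S_{kn}\text{ has exactly } m\ k\text{ -cycles}] = \frac{kn+1}{2}+\frac{(-1)^{n-m}}{2\,D(k,n-m)}, \] where $D(k,N)$ is the number of derangements of the generalized symmetric group $S(k,N)=(\mathbb{Z}/k\mathbb{Z})\wr S_N$.
   Context: A $k$-cycle of a permutation is a cycle of length exactly $k$ in its disjoint cycle decomposition (fixed points count as $1$-cycles). The generalized symmetric group $S(k,N)=(\mathbb{Z}/k\mathbb{Z})\wr S_N=(\mathbb{Z}/k\mathbb{Z})^N\rtimes S_N$ has elements $((x_1,\dots,x_N),\sigma)$ with $x_i\in\mathbb{Z}/k\mathbb{Z}$, $\sigma\in S_N$. Such an element is a derangement if for every $i\in\{1,\dots,N\}$, either $\sigma(i)\neq i$ or $x_i\neq 0$. $D(k,N)$ denotes the number of derangements of $S(k,N)$; in particular $D(k,0)=1$. -}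

module Defs where

open import Data.Nat as ℕ using (ℕ; zero; suc; _+_; _*_; _≡ᵇ_)
open import Data.Bool using (Bool; true; false; not; _∧_; _∨_; if_then_else_)
open import Data.Fin using (Fin; zero; suc; toℕ; _≟_)
open import Data.Vec using (Vec; []; _∷_; lookup)
open import Data.List using (List; []; _∷_; [_]; map; concatMap; filterᵇ; length; allFin)
open import Data.Bool.ListAction using () renaming (all to allL)
open import Data.Nat.ListAction using (sum)
open import Data.Product using (_×_; _,_)
open import Data.Integer using (ℤ; +_; -_; _^_)
open import Data.Rational using (ℚ; 0ℚ) renaming (_/_ to _/ℚ_)
open import Relation.Nullary.Decidable using (⌊_⌋)

_==_ : ∀ {n} → Fin n → Fin n → Bool
i == j = ⌊ i ≟ j ⌋

allB : ∀ {n} → (Fin n → Bool) → Bool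
allB {n} p = allL p (allFin n)

allVecs : ∀ {A : Set} (N : ℕ) → List A → List (Vec A N)
allVecs zero    xs = [ [] ]
allVecs (suc N) xs = concatMap (λ x → map (x ∷_) (allVecs N xs)) xs

-- a permutation of {1,…,N} is represented by its one-line notation:
-- a vector σ with σ[i] = σ(i+1)-1, which is injective (hence bijective)
isPerm : ∀ {N} → Vec (Fin N) N → Bool
isPerm σ = allB λ i → allB λ j → not (lookup σ i == lookup σ j) ∨ (i == j)

Perms : (N : ℕ) → List (Vec (Fin N) N)
Perms N = filterᵇ isPerm (allVecs N (allFin N))

iter : ∀ {N} → Vec (Fin N) N → ℕ → Fin N → Fin N
iter σ zero    i = i
iter σ (suc t) i = lookup σ (iter σ t i)

inKCycle : ∀ {N} → ℕ → Vec (Fin N) N → Fin N → Bool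
inKCycle {N} k σ i =
  (iter σ k i == i) ∧ allL (λ t → not (iter σ (suc (toℕ t)) i == i)) (allFin (k ℕ.∸ 1))

countB : ∀ {N} → (Fin N → Bool) → ℕ
countB {N} p = length (filterᵇ p (allFin N))

divℕ : ℕ → ℕ → ℕ
divℕ a zero    = 0
divℕ a (suc k) = ℕ._/_ a (suc k)

numKCycles : ∀ {N} → ℕ → Vec (Fin N) N → ℕ
numKCycles k σ = divℕ (countB (inKCycle k σ)) k

-- derangements of S(k,N) = (ℤ/kℤ)^N ⋊ S_N: pairs (x, σ) such that
-- for every i, σ(i) ≠ i or x_i ≠ 0
isDerangement : ∀ {k N} → Vec (Fin k) N × Vec (Fin N) N → Bool
isDerangement (x , σ) = allB λ i → not (lookup σ i == i) ∨ not (toℕ (lookup x i) ≡ᵇ 0)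

D : ℕ → ℕ → ℕ
D k N = length (filterᵇ isDerangement
          (concatMap (λ x → map (x ,_) (Perms N)) (allVecs N (allFin k))))

valAt1 : ∀ {N} → Vec (Fin N) N → ℕ
valAt1 []      = 0
valAt1 (x ∷ _) = suc (toℕ x)

PermsWithKCycles : (k N m : ℕ) → List (Vec (Fin N) N)
PermsWithKCycles k N m = filterᵇ (λ σ → numKCycles k σ ≡ᵇ m) (Perms N)

divℚ : ℤ → ℕ → ℚ
divℚ p zero    = 0ℚ
divℚ p (suc d) = p /ℚ suc d

expectedVal1 : ℕ → ℕ → ℕ → ℚ
expectedVal1 k N m =
  divℚ (+ sum (map valAt1 (PermsWithKCycles k N m))) (length (PermsWithKCycles k N m))

{-# OPTIONS --safe #-}
-- Let A(N,m) be the number of permutations of N points with m k-cycles. By conjugation all values π(1) ≠ 1 are equally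
-- likely, and those with π(1) = 1 are counted by A(N-1,m), so twice the sum of the values π(1) is (N+1) A(N,m) + U with
-- U = A(N,m) - N A(N-1,m). Marking a point on a k-cycle and splitting that cycle off gives the recursion
-- k (m+1) A(N+k,m+1) N! = (N+k)! A(N,m), and Σ_m A(N,m) = N!. Together these determine A, and hence U, for N = kn:
--   n! k^n A(kn,m) = (kn)! C(n,m) D(k,n-m),   n! k^n U = (kn)! (-1)^(n-m) C(n,m),
-- whence U / A = (-1)^(n-m) / D(k,n-m). The numbers D(k,r) enter through D(k,r) = k r D(k,r-1) + (-1)^r, which follows
-- from the case k = 1 (counting fixed points) since a permutation with f fixed points carries (k-1)^f k^(r-f) labellings.
module Submission where

open import Defs
open import Data.Nat using (ℕ; zero; suc; _+_; _*_; _∸_; _<_; _≤_; _>_; z≤n; s≤s; _!)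
import Data.Nat as ℕ
import Data.Nat.Properties as ℕₚ
open import Data.Nat.Divisibility using (_∣_; divides; ∣-refl; ∣m∣n⇒∣m+n)
open import Data.Nat.DivMod using (_/_; m*n/n≡m; m<n*o⇒m/o<n)
open import Data.Nat.Induction using (<-rec)
open import Data.Bool using (Bool; true; false; T; not; _∧_; _∨_; if_then_else_)
open import Data.Bool.Properties using (T-∧; T?; ∧-identityʳ)
import Data.Bool.ListAction
open import Data.Fin using (Fin; zero; suc; toℕ; _↑ˡ_; _↑ʳ_; splitAt)
open import Data.Fin.Permutation.Components using (transpose; transpose-inverse)
import Data.Fin as Fin
import Data.Fin.Properties as Finₚ
open import Data.Vec using (Vec; []; _∷_; lookup; tabulate)
import Data.Vec as Vec
import Data.Vec.Properties as Vecₚ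
open import Data.List using (List; []; _∷_; map; concatMap; filter; length; allFin; upTo; _++_; cartesianProductWith)
import Data.List as List
import Data.List.Properties as Listₚ
open import Data.Nat.ListAction using (sum; product)
open import Data.List.Membership.Propositional using (_∈_)
open import Data.List.Membership.Propositional.Properties
open import Data.List.Relation.Unary.Any using (here; there; index)
open import Data.List.Relation.Unary.All using (All; []; _∷_)
import Data.List.Relation.Unary.All as All
import Data.List.Relation.Unary.All.Properties as Allₚ
open import Data.List.Relation.Unary.AllPairs using ([]; _∷_)
open import Data.List.Relation.Unary.Unique.Propositional using (Unique)
open import Data.List.Relation.Unary.Unique.Propositional.Properties using (cartesianProductWith⁺; allFin⁺; upTo⁺; filter⁺)
open import Data.Nat.Tactic.RingSolver using (solve-∀)
open import Data.Product using (∃; _×_; _,_; proj₁; proj₂)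
open import Data.Sum using (_⊎_; inj₁; inj₂; [_,_]′)
open import Data.Empty using (⊥-elim)
open import Data.Unit using (tt)
open import Relation.Nullary using (¬_; Dec; yes; no; does; contradiction)
open import Relation.Nullary.Decidable using (map′; _×-dec_; dec-true; dec-false)
open import Relation.Unary using (Decidable)
open import Function using (_∘_; id; Equivalence)
open import Relation.Binary.PropositionalEquality
open import Relation.Binary.Definitions using (DecidableEquality)
open import Data.Integer using (ℤ; +_; -_; _^_)
open import Data.Integer using (0ℤ; 1ℤ; -1ℤ; ∣_∣) renaming (_+_ to _+ᶻ_; _*_ to _*ᶻ_; _-_ to _-ᶻ_)
import Data.Integer.Properties as ℤₚ
open import Data.Integer.Tactic.RingSolver using () renaming (solve-∀ to solveℤ)
open import Data.Rational using () renaming (_+_ to _+ℚ_)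
import Data.Rational as ℚ
import Data.Rational.Properties as ℚₚ
open import Data.Rational.Unnormalised using (mkℚᵘ; *≡*)
import Data.Rational.Unnormalised as ℚᵘ
import Data.Rational.Unnormalised.Properties as ℚᵘₚ

-- Finite sums and double counting

-- U is as explicit as A because it solves the same linear recursion. Multiplying the recursion from
-- N - 1 to N + k - 1 points by N (N + k) shows that N A(N-1,m) obeys, along N = kn, the recursion
-- of A(N,m); hence so does the difference U. After rescaling by n! k^n / (kn)! this recursion is
-- the absorption rule (m+1) Q(n+1,m+1) = (n+1) Q(n,m) of binomial coefficients. Thus A and U differ
-- only in their row sums: n! k^n, the order of S(k,n), for rescaled A, against N! - N (N-1)! = 0
-- for U when n > 0. One obstacle is that `numKCycles` is a truncated quotient of the number of
-- points on k-cycles, so the recursion for points becomes one for cycles only once that number is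
-- known to be a multiple of k. A marked cycle is split off by straightening it one point at a time:
-- conjugations turn it into the standard cycle on the first k points, and the remainder is a
-- permutation of the other block. Quotients appear in cross-multiplied form throughout, and arrays
-- are taken over the integers because of the signs in U.

∑ : ∀ {A : Set} → List A → (A → ℕ) → ℕ
∑ xs f = sum (map f xs)

∑-cong-∈ : ∀ {A : Set} (xs : List A) {f g : A → ℕ} → (∀ {x} → x ∈ xs → f x ≡ g x) → ∑ xs f ≡ ∑ xs g
∑-cong-∈ []       eq = refl
∑-cong-∈ (x ∷ xs) eq = cong₂ _+_ (eq (here refl)) (∑-cong-∈ xs (eq ∘ there))

∑-cong : ∀ {A : Set} (xs : List A) {f g : A → ℕ} → (∀ x → f x ≡ g x) → ∑ xs f ≡ ∑ xs g
∑-cong xs eq = ∑-cong-∈ xs λ {x} _ → eq x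

∑-+ : ∀ {A : Set} (xs : List A) (f g : A → ℕ) → ∑ xs (λ x → f x + g x) ≡ ∑ xs f + ∑ xs g
∑-+ []       f g = refl
∑-+ (x ∷ xs) f g rewrite ∑-+ xs f g = lemma (f x) (g x) (∑ xs f) (∑ xs g)
  where
  lemma : ∀ a b c d → a + b + (c + d) ≡ a + c + (b + d)
  lemma = solve-∀

∑-const : ∀ {A : Set} (xs : List A) c → ∑ xs (λ _ → c) ≡ length xs * c
∑-const []       c = refl
∑-const (x ∷ xs) c = cong (_+_ c) (∑-const xs c)

∑-swap : ∀ {A B : Set} (xs : List A) (ys : List B) (f : A → B → ℕ) →
         ∑ xs (λ x → ∑ ys (f x)) ≡ ∑ ys (λ y → ∑ xs (λ x → f x y))
∑-swap []       ys f = sym (trans (∑-const ys 0) (ℕₚ.*-zeroʳ (length ys)))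
∑-swap (x ∷ xs) ys f = trans (cong (_+_ (∑ ys (f x))) (∑-swap xs ys f)) (sym (∑-+ ys (f x) _))

count : ∀ {A : Set} {P : A → Set} → Decidable P → List A → ℕ
count P? xs = length (filter P? xs)

-- The injection acts on positions: an index into the filtered `xs` goes to the index at which the
-- image occurs in the filtered `ys`. Uniqueness of `xs` makes distinct positions carry distinct
-- elements, and completeness of `ys` provides the target.
count-≤ : ∀ {A B : Set} {P : A → Set} {Q : B → Set} (P? : Decidable P) (Q? : Decidable Q) {xs : List A} {ys : List B} →
          Unique xs → (∀ y → y ∈ ys) → (f : A → B) → (∀ {x} → P x → Q (f x)) →
          (∀ {x x'} → P x → P x' → f x ≡ f x' → x ≡ x') → count P? xs ≤ count Q? ys
count-≤ {A} {B} {P} {Q} P? Q? {xs} {ys} uxs ys-all f PQ inj = Finₚ.injective⇒≤ pos-injective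
  where
  member : ∀ i → List.lookup (filter P? xs) i ∈ filter P? xs
  member i = ∈-lookup i
  holds : ∀ i → P (List.lookup (filter P? xs) i)
  holds i = proj₂ (∈-filter⁻ P? {xs = xs} (member i))
  pos : Fin (count P? xs) → Fin (count Q? ys)
  pos i = index (∈-filter⁺ Q? (ys-all (f (List.lookup (filter P? xs) i))) (PQ (holds i)))
  lookup-inj : ∀ {zs : List A} → Unique zs → ∀ i j → List.lookup zs i ≡ List.lookup zs j → i ≡ j
  lookup-inj (z∉ ∷ u) zero    zero    eq = refl
  lookup-inj (z∉ ∷ u) zero    (suc j) eq = ⊥-elim (All.lookup z∉ (∈-lookup j) eq)
  lookup-inj (z∉ ∷ u) (suc i) zero    eq = ⊥-elim (All.lookup z∉ (∈-lookup i) (sym eq))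
  lookup-inj (z∉ ∷ u) (suc i) (suc j) eq = cong suc (lookup-inj u i j eq)
  index-inj : ∀ {zs : List B} {y y'} (p : y ∈ zs) (q : y' ∈ zs) → index p ≡ index q → y ≡ y'
  index-inj (here refl) (here refl) eq = refl
  index-inj (there p)   (there q)   eq = index-inj p q (Finₚ.suc-injective eq)
  pos-injective : ∀ {i j} → pos i ≡ pos j → i ≡ j
  pos-injective {i} {j} eq = lookup-inj (filter⁺ P? uxs) i j (inj (holds i) (holds j) (index-inj _ _ eq))

count-bij : ∀ {A B : Set} {P : A → Set} {Q : B → Set} (P? : Decidable P) (Q? : Decidable Q) {xs : List A} {ys : List B} →
            Unique xs → (∀ x → x ∈ xs) → Unique ys → (∀ y → y ∈ ys) → (f : A → B) (g : B → A) →
            (∀ {x} → P x → Q (f x)) → (∀ {y} → Q y → P (g y)) →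
            (∀ {x} → P x → g (f x) ≡ x) → (∀ {y} → Q y → f (g y) ≡ y) → count P? xs ≡ count Q? ys
count-bij P? Q? uxs xs-all uys ys-all f g PQ QP gf fg = ℕₚ.≤-antisym
  (count-≤ P? Q? uxs ys-all f PQ λ p p' eq → trans (sym (gf p)) (trans (cong g eq) (gf p')))
  (count-≤ Q? P? uys xs-all g QP λ q q' eq → trans (sym (fg q)) (trans (cong f eq) (fg q')))

count-cong : ∀ {A : Set} {P Q : A → Set} (P? : Decidable P) (Q? : Decidable Q) (xs : List A) →
             (∀ {x} → P x → Q x) → (∀ {x} → Q x → P x) → count P? xs ≡ count Q? xs
count-cong P? Q? xs PQ QP = cong length (Listₚ.filter-≐ P? Q? (PQ , QP) xs)

count-none : ∀ {A : Set} {P : A → Set} (P? : Decidable P) (xs : List A) → (∀ {x} → ¬ P x) → count P? xs ≡ 0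
count-none P? xs ¬P = cong length (Listₚ.filter-none P? {xs = xs} (All.tabulate λ _ → ¬P))

filter-filter : ∀ {A : Set} {P Q : A → Set} (P? : Decidable P) (Q? : Decidable Q) (xs : List A) →
                filter Q? (filter P? xs) ≡ filter (λ x → P? x ×-dec Q? x) xs
filter-filter P? Q? []       = refl
filter-filter P? Q? (x ∷ xs) with does (P? x)
... | false = filter-filter P? Q? xs
... | true with does (Q? x)
...   | true  = cong (x ∷_) (filter-filter P? Q? xs)
...   | false = filter-filter P? Q? xs

𝟙 : Bool → ℕ
𝟙 true  = 1
𝟙 false = 0

𝟙-∧ : ∀ b c → 𝟙 (b ∧ c) ≡ 𝟙 b * 𝟙 c
𝟙-∧ true  c = sym (ℕₚ.+-identityʳ (𝟙 c))
𝟙-∧ false c = refl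

∑-filter : ∀ {A : Set} {P : A → Set} (P? : Decidable P) (xs : List A) (w : A → ℕ) →
           ∑ (filter P? xs) w ≡ ∑ xs (λ x → 𝟙 (does (P? x)) * w x)
∑-filter P? []       w = refl
∑-filter P? (x ∷ xs) w with does (P? x)
... | true  = cong₂ _+_ (sym (ℕₚ.+-identityʳ (w x))) (∑-filter P? xs w)
... | false = ∑-filter P? xs w

count-∑ : ∀ {A : Set} {P : A → Set} (P? : Decidable P) (xs : List A) → count P? xs ≡ ∑ xs (λ x → 𝟙 (does (P? x)))
count-∑ P? []       = refl
count-∑ P? (x ∷ xs) with does (P? x)
... | true  = cong suc (count-∑ P? xs)
... | false = count-∑ P? xs

∑-*ˡ : ∀ {A : Set} (xs : List A) c (f : A → ℕ) → ∑ xs (λ x → c * f x) ≡ c * ∑ xs f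
∑-*ˡ []       c f = sym (ℕₚ.*-zeroʳ c)
∑-*ˡ (x ∷ xs) c f = trans (cong (_+_ (c * f x)) (∑-*ˡ xs c f)) (sym (ℕₚ.*-distribˡ-+ c (f x) _))

∑-*ʳ : ∀ {A : Set} (xs : List A) c (f : A → ℕ) → ∑ xs (λ x → f x * c) ≡ ∑ xs f * c
∑-*ʳ xs c f = trans (∑-cong xs λ x → ℕₚ.*-comm (f x) c) (trans (∑-*ˡ xs c f) (ℕₚ.*-comm c _))

-- Filters become 0/1 factors, so the sums can be exchanged; the two indicators then fuse into that
-- of the conjunction.
∑-double-count : ∀ {A B : Set} {P : A → Set} {R : A → B → Set} (P? : Decidable P) (R? : ∀ x → Decidable (R x))
                 (xs : List A) (ys : List B) (w : B → ℕ) →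
                 ∑ (filter P? xs) (λ x → ∑ (filter (R? x) ys) w) ≡
                 ∑ ys (λ y → count (λ x → P? x ×-dec R? x y) xs * w y)
∑-double-count P? R? xs ys w = begin
  ∑ (filter P? xs) (λ x → ∑ (filter (R? x) ys) w)
    ≡⟨ ∑-filter P? xs _ ⟩
  ∑ xs (λ x → 𝟙 (does (P? x)) * ∑ (filter (R? x) ys) w)
    ≡⟨ ∑-cong xs (λ x → trans (cong (𝟙 (does (P? x)) *_) (∑-filter (R? x) ys w)) (sym (∑-*ˡ ys (𝟙 (does (P? x))) _))) ⟩
  ∑ xs (λ x → ∑ ys (λ y → 𝟙 (does (P? x)) * (𝟙 (does (R? x y)) * w y)))
    ≡⟨ ∑-swap xs ys _ ⟩
  ∑ ys (λ y → ∑ xs (λ x → 𝟙 (does (P? x)) * (𝟙 (does (R? x y)) * w y)))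
    ≡⟨ ∑-cong ys (λ y → ∑-cong xs λ x → trans (sym (ℕₚ.*-assoc (𝟙 (does (P? x))) (𝟙 (does (R? x y))) (w y)))
                                             (cong (_* w y) (sym (𝟙-∧ (does (P? x)) (does (R? x y)))))) ⟩
  ∑ ys (λ y → ∑ xs (λ x → 𝟙 (does (P? x) ∧ does (R? x y)) * w y))
    ≡⟨ ∑-cong ys (λ y → trans (∑-*ʳ xs (w y) _) (cong (_* w y) (sym (count-∑ (λ x → P? x ×-dec R? x y) xs)))) ⟩
  ∑ ys (λ y → count (λ x → P? x ×-dec R? x y) xs * w y) ∎
  where open ≡-Reasoning

∑-filter-≡ : ∀ {B : Set} (_≟_ : DecidableEquality B) {ys : List B} → Unique ys → ∀ {b} → b ∈ ys → (w : B → ℕ) →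
             ∑ (filter (b ≟_) ys) w ≡ w b
∑-filter-≡ _≟_ {y ∷ ys} (y∉ ∷ u) {b} (here refl) w
  rewrite Listₚ.filter-accept (b ≟_) {xs = ys} refl
        | Listₚ.filter-none (b ≟_) {xs = ys} y∉ = ℕₚ.+-identityʳ (w b)
∑-filter-≡ _≟_ {y ∷ ys} (y∉ ∷ u) {b} (there b∈) w
  rewrite Listₚ.filter-reject (b ≟_) {xs = ys} (λ b≡y → All.lookup y∉ b∈ (sym b≡y)) = ∑-filter-≡ _≟_ u b∈ w

-- Each `w (h x)` is a sum over the single `y` equal to `h x`; double counting the pairs then groups
-- the `x` by their value under `h`.
∑-fibres : ∀ {A B : Set} {P : A → Set} (P? : Decidable P) (_≟_ : DecidableEquality B) (h : A → B)
           (xs : List A) {ys : List B} → Unique ys → (∀ {x} → P x → h x ∈ ys) → (w : B → ℕ) →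
           ∑ (filter P? xs) (w ∘ h) ≡ ∑ ys (λ y → count (λ x → P? x ×-dec (h x ≟ y)) xs * w y)
∑-fibres P? _≟_ h xs {ys} uys h∈ w = trans
  (∑-cong-∈ (filter P? xs) λ {x} x∈ → sym (∑-filter-≡ _≟_ uys (h∈ (proj₂ (∈-filter⁻ P? {xs = xs} x∈))) w))
  (∑-double-count P? (λ x y → h x ≟ y) xs ys w)

count-fibres : ∀ {A B : Set} {P : A → Set} (P? : Decidable P) (_≟_ : DecidableEquality B) (h : A → B)
               (xs : List A) {ys : List B} → Unique ys → (∀ {x} → P x → h x ∈ ys) →
               count P? xs ≡ ∑ ys (λ y → count (λ x → P? x ×-dec (h x ≟ y)) xs)
count-fibres P? _≟_ h xs {ys} uys h∈ = begin
  count P? xs                ≡⟨ ℕₚ.*-identityʳ _ ⟨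
  count P? xs * 1            ≡⟨ ∑-const (filter P? xs) 1 ⟨
  ∑ (filter P? xs) (λ _ → 1) ≡⟨ ∑-fibres P? _≟_ h xs uys h∈ (λ _ → 1) ⟩
  ∑ ys (λ y → count (λ x → P? x ×-dec (h x ≟ y)) xs * 1) ≡⟨ ∑-cong ys (λ y → ℕₚ.*-identityʳ _) ⟩
  ∑ ys (λ y → count (λ x → P? x ×-dec (h x ≟ y)) xs) ∎
  where open ≡-Reasoning

allVecs-product : ∀ {A : Set} N (xs : List A) → allVecs (suc N) xs ≡ cartesianProductWith _∷_ xs (allVecs N xs)
allVecs-product {A} N xs = go xs
  where
  go : ∀ ys → concatMap (λ x → map (x ∷_) (allVecs N xs)) ys ≡ cartesianProductWith _∷_ ys (allVecs N xs)
  go []       = refl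
  go (y ∷ ys) = cong (map (y ∷_) (allVecs N xs) ++_) (go ys)

allVecs-unique : ∀ {A : Set} N {xs : List A} → Unique xs → Unique (allVecs N xs)
allVecs-unique zero    u = [] ∷ []
allVecs-unique (suc N) {xs} u rewrite allVecs-product N xs =
  cartesianProductWith⁺ _∷_ Vecₚ.∷-injective u (allVecs-unique N u)

allVecs-complete : ∀ {A : Set} N {xs : List A} → (∀ x → x ∈ xs) → ∀ v → v ∈ allVecs N xs
allVecs-complete zero    all [] = here refl
allVecs-complete (suc N) {xs} all (x ∷ v) rewrite allVecs-product N xs =
  ∈-cartesianProductWith⁺ _∷_ (all x) (allVecs-complete N all v)

Maps : ∀ N → List (Vec (Fin N) N)
Maps N = allVecs N (allFin N)

Maps-unique : ∀ N → Unique (Maps N)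
Maps-unique N = allVecs-unique N (allFin⁺ N)

Maps-complete : ∀ {N} (σ : Vec (Fin N) N) → σ ∈ Maps N
Maps-complete {N} = allVecs-complete N ∈-allFin

-- Permutations and their k-cycles

T-allB⁻ : ∀ {n} {p : Fin n → Bool} → T (allB p) → ∀ i → T (p i)
T-allB⁻ {n} {p} t i = All.lookup (Allₚ.all⁺ p (allFin n) t) (∈-allFin i)

T-allB⁺ : ∀ {n} {p : Fin n → Bool} → (∀ i → T (p i)) → T (allB p)
T-allB⁺ {n} {p} t = Allₚ.all⁻ p {xs = allFin n} (All.tabulate λ {i} _ → t i)

record Perm {N} (σ : Vec (Fin N) N) : Set where
  constructor perm
  field injective : ∀ {i j} → lookup σ i ≡ lookup σ j → i ≡ j

open Perm

isPerm⇒Perm : ∀ {N} {σ : Vec (Fin N) N} → T (isPerm σ) → Perm σ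
isPerm⇒Perm {σ = σ} p = perm λ {i} {j} → entry i j
  where
  entry : ∀ i j → lookup σ i ≡ lookup σ j → i ≡ j
  entry i j eq with lookup σ i Fin.≟ lookup σ j | i Fin.≟ j | T-allB⁻ (T-allB⁻ p i) j
  ... | _      | yes i≡j | _ = i≡j
  ... | no neq | no _    | _ = contradiction eq neq

Perm⇒isPerm : ∀ {N} {σ : Vec (Fin N) N} → Perm σ → T (isPerm σ)
Perm⇒isPerm {σ = σ} p = T-allB⁺ λ i → T-allB⁺ λ j → entry i j
  where
  entry : ∀ i j → T (not (lookup σ i == lookup σ j) ∨ (i == j))
  entry i j with lookup σ i Fin.≟ lookup σ j | i Fin.≟ j
  ... | no _   | _       = tt
  ... | yes eq | yes _   = tt
  ... | yes eq | no i≢j  = contradiction (injective p eq) i≢j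

Perm? : ∀ {N} → Decidable (Perm {N})
Perm? σ = map′ isPerm⇒Perm Perm⇒isPerm (T? (isPerm σ))

lookup-ext : ∀ {A : Set} {n} {v w : Vec A n} → (∀ i → lookup v i ≡ lookup w i) → v ≡ w
lookup-ext {v = v} {w} eq = trans (sym (Vecₚ.tabulate∘lookup v)) (trans (Vecₚ.tabulate-cong eq) (Vecₚ.tabulate∘lookup w))

kCyclePoints : ∀ {N} → ℕ → Vec (Fin N) N → ℕ
kCyclePoints k σ = countB (inKCycle k σ)

T-==⁻ : ∀ {n} {i j : Fin n} → T (i == j) → i ≡ j
T-==⁻ {i = i} {j} t with i Fin.≟ j
... | yes eq = eq

T-==⁺ : ∀ {n} {i j : Fin n} → i ≡ j → T (i == j)
T-==⁺ {i = i} {j} eq with i Fin.≟ j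
... | yes _  = tt
... | no neq = neq eq

T-≢⁻ : ∀ {n} {i j : Fin n} → T (not (i == j)) → i ≢ j
T-≢⁻ {i = i} {j} t with i Fin.≟ j
... | no neq = neq

T-≢⁺ : ∀ {n} {i j : Fin n} → i ≢ j → T (not (i == j))
T-≢⁺ {i = i} {j} neq with i Fin.≟ j
... | yes eq = neq eq
... | no _   = tt

record InKCycle {N} (k : ℕ) (σ : Vec (Fin N) N) (i : Fin N) : Set where
  constructor inCycle
  field
    returns : iter σ k i ≡ i
    minimal : ∀ {t} → suc t < k → iter σ (suc t) i ≢ i

open InKCycle

inKCycle⁻ : ∀ {N} k {σ : Vec (Fin N) N} {i} → T (inKCycle k σ i) → InKCycle k σ i
inKCycle⁻ k {σ} {i} inK = inCycle (T-==⁻ (proj₁ (Equivalence.to T-∧ inK))) λ {t} st<k →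
  let t<k∸1 = ℕₚ.∸-monoˡ-≤ 1 st<k in
  subst (λ s → iter σ (suc s) i ≢ i) (Finₚ.toℕ-fromℕ< t<k∸1)
    (T-≢⁻ (T-allB⁻ (proj₂ (Equivalence.to (T-∧ {iter σ k i == i}) inK)) (Fin.fromℕ< t<k∸1)))

inKCycle⁺ : ∀ {N} k {σ : Vec (Fin N) N} {i} → InKCycle k σ i → T (inKCycle k σ i)
inKCycle⁺ zero    inK = Equivalence.from T-∧ (T-==⁺ refl , tt)
inKCycle⁺ (suc k) {σ} {i} inK = Equivalence.from (T-∧ {iter σ (suc k) i == i})
  (T-==⁺ (returns inK) , T-allB⁺ λ t → T-≢⁺ (minimal inK (s≤s (Finₚ.toℕ<n t))))

InKCycle? : ∀ {N} k (σ : Vec (Fin N) N) → Decidable (InKCycle k σ)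
InKCycle? k σ i = map′ (inKCycle⁻ k) (inKCycle⁺ k) (T? (inKCycle k σ i))

-- Equivariant maps and conjugation

==-injective : ∀ {m n} (φ : Fin m → Fin n) → (∀ {i j} → φ i ≡ φ j → i ≡ j) → ∀ i j → (φ i == φ j) ≡ (i == j)
==-injective φ inj i j with φ i Fin.≟ φ j | i Fin.≟ j
... | yes _  | yes _  = refl
... | no _   | no _   = refl
... | yes eq | no neq = contradiction (inj eq) neq
... | no neq | yes eq = contradiction (cong φ eq) neq

module Intertwining {m n} {σ : Vec (Fin m) m} {σ' : Vec (Fin n) n} (φ : Fin m → Fin n)
                    (step : ∀ i → lookup σ' (φ i) ≡ φ (lookup σ i)) where

  iter-intertwine : ∀ t i → iter σ' t (φ i) ≡ φ (iter σ t i)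
  iter-intertwine zero    i = refl
  iter-intertwine (suc t) i = trans (cong (lookup σ') (iter-intertwine t i)) (step _)

  -- An equivariant injection preserves return times, hence cycle lengths. This serves conjugation
  -- as well as the two inclusions into a block sum.
  inKCycle-intertwine : (∀ {i j} → φ i ≡ φ j → i ≡ j) → ∀ k i → inKCycle k σ' (φ i) ≡ inKCycle k σ i
  inKCycle-intertwine inj k i = cong₂ _∧_ (return≡ k)
    (cong Data.Bool.ListAction.and (Listₚ.map-cong (λ t → cong not (return≡ (suc (toℕ t)))) (allFin (k ∸ 1))))
    where
    return≡ : ∀ t → (iter σ' t (φ i) == φ i) ≡ (iter σ t i == i)
    return≡ t = trans (cong (_== φ i) (iter-intertwine t i)) (==-injective φ inj _ _)

open Intertwining using (iter-intertwine; inKCycle-intertwine)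

-- `τ` stands in the place of its inverse as well: conjugation is only ever by involutions, namely
-- transpositions.
conj : ∀ {N} → (Fin N → Fin N) → Vec (Fin N) N → Vec (Fin N) N
conj τ σ = tabulate λ i → τ (lookup σ (τ i))

module Conjugation {N} {τ : Fin N → Fin N} (invol : ∀ i → τ (τ i) ≡ i) where

  τ-injective : ∀ {i j} → τ i ≡ τ j → i ≡ j
  τ-injective {i} {j} eq = trans (sym (invol i)) (trans (cong τ eq) (invol j))

  lookup-conj : ∀ σ i → lookup (conj τ σ) (τ i) ≡ τ (lookup σ i)
  lookup-conj σ i = trans (Vecₚ.lookup∘tabulate _ (τ i)) (cong (τ ∘ lookup σ) (invol i))

  conj-involutive : ∀ σ → conj τ (conj τ σ) ≡ σ
  conj-involutive σ = lookup-ext λ i →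
    trans (Vecₚ.lookup∘tabulate _ i) (trans (cong τ (lookup-conj σ i)) (invol _))

  conj-Perm : ∀ {σ} → Perm σ → Perm (conj τ σ)
  conj-Perm {σ} p = perm λ {i} {j} eq → τ-injective (injective p (τ-injective
    (trans (sym (Vecₚ.lookup∘tabulate _ i)) (trans eq (Vecₚ.lookup∘tabulate _ j)))))

  iter-conj : ∀ σ t i → iter (conj τ σ) t (τ i) ≡ τ (iter σ t i)
  iter-conj σ = iter-intertwine τ (lookup-conj σ)

  inKCycle-conj : ∀ k σ i → inKCycle k (conj τ σ) (τ i) ≡ inKCycle k σ i
  inKCycle-conj k σ = inKCycle-intertwine τ (lookup-conj σ) τ-injective k

  kCyclePoints-conj : ∀ k σ → kCyclePoints k (conj τ σ) ≡ kCyclePoints k σ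
  kCyclePoints-conj k σ = count-bij (λ i → T? (inKCycle k (conj τ σ) i)) (λ i → T? (inKCycle k σ i))
    (allFin⁺ N) ∈-allFin (allFin⁺ N) ∈-allFin τ τ
    (λ {i} → subst T (trans (cong (inKCycle k (conj τ σ)) (sym (invol i))) (inKCycle-conj k σ (τ i))))
    (λ {i} → subst T (sym (inKCycle-conj k σ i)))
    (λ {i} _ → invol i) (λ {i} _ → invol i)

  count-conj : ∀ {P Q : Vec (Fin N) N → Set} (P? : Decidable P) (Q? : Decidable Q) →
               (∀ {σ} → P σ → Q (conj τ σ)) → (∀ {σ} → Q σ → P (conj τ σ)) →
               count P? (Maps N) ≡ count Q? (Maps N)
  count-conj P? Q? PQ QP = count-bij P? Q? (Maps-unique N) Maps-complete (Maps-unique N) Maps-complete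
    (conj τ) (conj τ) PQ QP (λ {σ} _ → conj-involutive σ) (λ {σ} _ → conj-involutive σ)

-- The known inverse of `transpose i j` is `transpose j i`; identifying the two makes a
-- transposition an involution.
transpose-comm : ∀ {n} (i j k : Fin n) → transpose i j k ≡ transpose j i k
transpose-comm i j k with k Fin.≟ i | k Fin.≟ j
... | yes refl | yes refl = refl
... | yes refl | no k≢j rewrite dec-true (k Fin.≟ k) refl = refl
... | no k≢i | yes refl rewrite dec-true (k Fin.≟ k) refl = refl
... | no k≢i | no k≢j rewrite dec-false (k Fin.≟ i) k≢i | dec-false (k Fin.≟ j) k≢j = refl

transpose-involutive : ∀ {n} (i j : Fin n) k → transpose i j (transpose i j k) ≡ k
transpose-involutive i j k = trans (cong (transpose i j) (transpose-comm i j k)) (transpose-inverse i j)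

transpose-fst : ∀ {n} (i j : Fin n) → transpose i j i ≡ j
transpose-fst i j rewrite dec-true (i Fin.≟ i) refl = refl

transpose-snd : ∀ {n} (i j : Fin n) → transpose i j j ≡ i
transpose-snd i j = trans (transpose-comm i j j) (transpose-fst j i)

transpose-other : ∀ {n} {i j k : Fin n} → k ≢ i → k ≢ j → transpose i j k ≡ k
transpose-other {i = i} {j} {k} k≢i k≢j rewrite dec-false (k Fin.≟ i) k≢i | dec-false (k Fin.≟ j) k≢j = refl

-- Block sums of permutations

infixr 5 _⊕_

_⊕_ : ∀ {a M} → Vec (Fin a) a → Vec (Fin M) M → Vec (Fin (a + M)) (a + M)
_⊕_ {a} {M} ρ σ = Vec.map (_↑ˡ M) ρ Vec.++ Vec.map (a ↑ʳ_) σ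

data Side (a M : ℕ) : Fin (a + M) → Set where
  left  : ∀ i → Side a M (i ↑ˡ M)
  right : ∀ j → Side a M (a ↑ʳ j)

side : ∀ a M x → Side a M x
side a M x with splitAt a {M} x in eq
... | inj₁ i = subst (Side a M) (Finₚ.splitAt⁻¹-↑ˡ eq) (left i)
... | inj₂ j = subst (Side a M) (Finₚ.splitAt⁻¹-↑ʳ eq) (right j)

↑ˡ≢↑ʳ : ∀ {a M} (i : Fin a) (j : Fin M) → i ↑ˡ M ≢ a ↑ʳ j
↑ˡ≢↑ʳ {a} {M} i j eq with trans (sym (Finₚ.splitAt-↑ˡ a i M)) (trans (cong (splitAt a) eq) (Finₚ.splitAt-↑ʳ a M j))
... | ()

module _ {a M : ℕ} (ρ : Vec (Fin a) a) (σ : Vec (Fin M) M) where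

  lookup-⊕ˡ : ∀ i → lookup (ρ ⊕ σ) (i ↑ˡ M) ≡ lookup ρ i ↑ˡ M
  lookup-⊕ˡ i = trans (Vecₚ.lookup-++ˡ (Vec.map (_↑ˡ M) ρ) _ i) (Vecₚ.lookup-map i _ ρ)

  lookup-⊕ʳ : ∀ j → lookup (ρ ⊕ σ) (a ↑ʳ j) ≡ a ↑ʳ lookup σ j
  lookup-⊕ʳ j = trans (Vecₚ.lookup-++ʳ (Vec.map (_↑ˡ M) ρ) _ j) (Vecₚ.lookup-map j _ σ)

  ⊕-Perm : Perm ρ → Perm σ → Perm (ρ ⊕ σ)
  ⊕-Perm pρ pσ = perm λ {x} {y} → inj (side a M x) (side a M y)
    where
    inj : ∀ {x y} → Side a M x → Side a M y → lookup (ρ ⊕ σ) x ≡ lookup (ρ ⊕ σ) y → x ≡ y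
    inj (left i) (left j) eq = cong (_↑ˡ M) (injective pρ
      (Finₚ.↑ˡ-injective M _ _ (trans (sym (lookup-⊕ˡ i)) (trans eq (lookup-⊕ˡ j)))))
    inj (left i) (right j) eq = contradiction (trans (sym (lookup-⊕ˡ i)) (trans eq (lookup-⊕ʳ j))) (↑ˡ≢↑ʳ _ _)
    inj (right i) (left j) eq = contradiction (trans (sym (lookup-⊕ˡ j)) (trans (sym eq) (lookup-⊕ʳ i))) (↑ˡ≢↑ʳ _ _)
    inj (right i) (right j) eq = cong (a ↑ʳ_) (injective pσ
      (Finₚ.↑ʳ-injective a _ _ (trans (sym (lookup-⊕ʳ i)) (trans eq (lookup-⊕ʳ j)))))

  ⊕-Perm⁻ : Perm (ρ ⊕ σ) → Perm σ
  ⊕-Perm⁻ p = perm λ {i} {j} eq → Finₚ.↑ʳ-injective a i j (injective p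
    (trans (lookup-⊕ʳ i) (trans (cong (a ↑ʳ_) eq) (sym (lookup-⊕ʳ j)))))

  kCyclePoints-⊕ : ∀ k → kCyclePoints k (ρ ⊕ σ) ≡ kCyclePoints k ρ + kCyclePoints k σ
  kCyclePoints-⊕ k = begin
    kCyclePoints k (ρ ⊕ σ)
      ≡⟨ countB-tabulate (inKCycle k (ρ ⊕ σ)) ⟩
    sum (List.tabulate (𝟙 ∘ inKCycle k (ρ ⊕ σ)))
      ≡⟨ sum-tabulate-+ a (𝟙 ∘ inKCycle k (ρ ⊕ σ)) ⟩
    sum (List.tabulate (𝟙 ∘ inKCycle k (ρ ⊕ σ) ∘ (_↑ˡ M))) + sum (List.tabulate (𝟙 ∘ inKCycle k (ρ ⊕ σ) ∘ (a ↑ʳ_)))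
      ≡⟨ cong₂ _+_
           (cong sum (Listₚ.tabulate-cong λ i → cong 𝟙 (inKCycle-intertwine (_↑ˡ M) lookup-⊕ˡ (Finₚ.↑ˡ-injective M _ _) k i)))
           (cong sum (Listₚ.tabulate-cong λ i → cong 𝟙 (inKCycle-intertwine (a ↑ʳ_) lookup-⊕ʳ (Finₚ.↑ʳ-injective a _ _) k i))) ⟩
    sum (List.tabulate (𝟙 ∘ inKCycle k ρ)) + sum (List.tabulate (𝟙 ∘ inKCycle k σ))
      ≡⟨ cong₂ _+_ (countB-tabulate (inKCycle k ρ)) (countB-tabulate (inKCycle k σ)) ⟨
    kCyclePoints k ρ + kCyclePoints k σ ∎
    where
    open ≡-Reasoning
    countB-tabulate : ∀ {n} (p : Fin n → Bool) → countB p ≡ sum (List.tabulate (𝟙 ∘ p))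
    countB-tabulate {n} p = trans (count-∑ (T? ∘ p) (allFin n)) (cong sum (Listₚ.map-tabulate id (𝟙 ∘ p)))
    sum-tabulate-+ : ∀ b {n} (f : Fin (b + n) → ℕ) →
      sum (List.tabulate f) ≡ sum (List.tabulate (f ∘ (_↑ˡ n))) + sum (List.tabulate (f ∘ (b ↑ʳ_)))
    sum-tabulate-+ zero    f = refl
    sum-tabulate-+ (suc b) f = trans (cong (_+_ (f zero)) (sum-tabulate-+ b (f ∘ suc))) (sym (ℕₚ.+-assoc (f zero) _ _))

Extends : ∀ {a M} → Vec (Fin a) a → Vec (Fin (a + M)) (a + M) → Set
Extends {a} {M} ρ σ = ∀ i → lookup σ (i ↑ˡ M) ≡ lookup ρ i ↑ˡ M

-- The left half of Fin (a + M) is junk here; it is never reached on permutations preserving the left block.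
restrictʳ : ∀ a {M} → Vec (Fin (a + M)) (a + M) → Vec (Fin M) M
restrictʳ a σ = tabulate λ j → [ (λ _ → j) , id ]′ (splitAt a (lookup σ (a ↑ʳ j)))

restrictʳ-⊕ : ∀ {a M} (ρ : Vec (Fin a) a) (σ : Vec (Fin M) M) → restrictʳ a (ρ ⊕ σ) ≡ σ
restrictʳ-⊕ {a} {M} ρ σ = lookup-ext λ j → trans (Vecₚ.lookup∘tabulate _ j)
  (cong [ (λ _ → j) , id ]′ (trans (cong (splitAt a) (lookup-⊕ʳ ρ σ j)) (Finₚ.splitAt-↑ʳ a M _)))

-- Surjectivity of `ρ` keeps the right block invariant: every value in the left block is already
-- taken by a point of that block, so by injectivity no point of the right block can reach it.
⊕-restrictʳ : ∀ {a M} {ρ : Vec (Fin a) a} {σ : Vec (Fin (a + M)) (a + M)} → (∀ i → ∃ λ j → lookup ρ j ≡ i) →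
              Perm σ → Extends ρ σ → ρ ⊕ restrictʳ a σ ≡ σ
⊕-restrictʳ {a} {M} {ρ} {σ} surj p ext = lookup-ext λ x → agree (side a M x)
  where
  image : ∀ j {y} → Side a M y → lookup σ (a ↑ʳ j) ≡ y →
          a ↑ʳ ([ (λ _ → j) , id ]′ (splitAt a y)) ≡ y
  image j (right j') eq = cong (λ s → a ↑ʳ [ (λ _ → j) , id ]′ s) (Finₚ.splitAt-↑ʳ a M j')
  image j (left i) eq with surj i
  ... | i' , refl = contradiction (injective p (trans (ext i') (sym eq))) (↑ˡ≢↑ʳ i' j)
  agree : ∀ {x} → Side a M x → lookup (ρ ⊕ restrictʳ a σ) x ≡ lookup σ x
  agree (left i)  = trans (lookup-⊕ˡ ρ (restrictʳ a σ) i) (sym (ext i))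
  agree (right j) = trans (lookup-⊕ʳ ρ (restrictʳ a σ) j)
    (trans (cong (a ↑ʳ_) (Vecₚ.lookup∘tabulate _ j)) (image j (side a M _) refl))

-- Restriction to the right block and `ρ ⊕_` are mutually inverse on the permutations concerned.
-- Applied with `id₁` this removes a fixed first point, with `rot k` a standard cycle on the first
-- points.
count-extensions : ∀ {a M} {ρ : Vec (Fin a) a} → (∀ i → ∃ λ j → lookup ρ j ≡ i) →
  {P : Vec (Fin (a + M)) (a + M) → Set} {Q : Vec (Fin M) M → Set} (P? : Decidable P) (Q? : Decidable Q) →
  (∀ {σ} → P σ → Perm σ × Extends ρ σ) → (∀ {σ} → Q σ → P (ρ ⊕ σ)) → (∀ {σ} → P (ρ ⊕ σ) → Q σ) →
  count P? (Maps (a + M)) ≡ count Q? (Maps M)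
count-extensions {a} {M} {ρ} surj {P} P? Q? sound QP PQ = count-bij P? Q?
  (Maps-unique _) Maps-complete (Maps-unique _) Maps-complete (restrictʳ a) (ρ ⊕_)
  (λ p → PQ (subst P (sym (rebuild p)) p)) QP rebuild (λ {σ} _ → restrictʳ-⊕ ρ σ)
  where
  rebuild : ∀ {σ} → P σ → ρ ⊕ restrictʳ a σ ≡ σ
  rebuild p = ⊕-restrictʳ surj (proj₁ (sound p)) (proj₂ (sound p))

-- Splitting off a k-cycle

-- The transposition is applied to the values only. This may change the cycle type, which is
-- harmless while only injectivity is at stake.
swap-Perm-head : ∀ {N} (j : Fin (suc N)) →
  count (λ σ → Perm? σ ×-dec (lookup σ zero Fin.≟ j)) (Maps (suc N)) ≡
  count (λ σ → Perm? σ ×-dec (lookup σ zero Fin.≟ zero)) (Maps (suc N))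
swap-Perm-head {N} j = count-bij _ _ (Maps-unique _) Maps-complete (Maps-unique _) Maps-complete
  (Vec.map τ) (Vec.map τ)
  (λ { {σ} (p , eq) → map-Perm p , trans (Vecₚ.lookup-map zero τ σ) (trans (cong τ eq) (transpose-snd zero j)) })
  (λ { {σ} (p , eq) → map-Perm p , trans (Vecₚ.lookup-map zero τ σ) (trans (cong τ eq) (transpose-fst zero j)) })
  (λ {σ} _ → map-invol σ) (λ {σ} _ → map-invol σ)
  where
  τ : Fin (suc N) → Fin (suc N)
  τ = transpose zero j
  open Conjugation {τ = τ} (transpose-involutive zero j) using (τ-injective)
  map-Perm : ∀ {σ} → Perm σ → Perm (Vec.map τ σ)
  map-Perm {σ} p = perm λ {x} {y} eq → injective p (τ-injective
    (trans (sym (Vecₚ.lookup-map x τ σ)) (trans eq (Vecₚ.lookup-map y τ σ))))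
  map-invol : ∀ σ → Vec.map τ (Vec.map τ σ) ≡ σ
  map-invol σ = trans (sym (Vecₚ.map-∘ τ τ σ)) (trans (Vecₚ.map-cong (transpose-involutive zero j) σ) (Vecₚ.map-id σ))

id₁ : Vec (Fin 1) 1
id₁ = zero ∷ []

id₁-Perm : Perm id₁
id₁-Perm = perm λ { {zero} {zero} _ → refl }

id₁-surjective : ∀ i → ∃ λ j → lookup id₁ j ≡ i
id₁-surjective zero = zero , refl

count-fixing-first : ∀ {N} {P : Vec (Fin (suc N)) (suc N) → Set} {Q : Vec (Fin N) N → Set}
  (P? : Decidable P) (Q? : Decidable Q) → (∀ {σ} → P σ → Perm σ) → (∀ {σ} → Q σ → P (id₁ ⊕ σ)) → (∀ {σ} → P (id₁ ⊕ σ) → Q σ) →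
  count (λ σ → P? σ ×-dec (lookup σ zero Fin.≟ zero)) (Maps (suc N)) ≡ count Q? (Maps N)
count-fixing-first P? Q? P⇒Perm QP PQ = count-extensions id₁-surjective _ Q?
  (λ { (p , eq) → P⇒Perm p , λ { zero → eq } }) (λ q → QP q , refl) (λ { (p , _) → PQ p })

count-Perm : ∀ N → count Perm? (Maps N) ≡ N !
count-Perm zero    = refl
count-Perm (suc N) = begin
  count Perm? (Maps (suc N))
    ≡⟨ count-fibres Perm? Fin._≟_ (λ σ → lookup σ zero) (Maps (suc N)) (allFin⁺ (suc N)) (λ _ → ∈-allFin _) ⟩
  ∑ (allFin (suc N)) (λ j → count (λ σ → Perm? σ ×-dec (lookup σ zero Fin.≟ j)) (Maps (suc N)))
    ≡⟨ ∑-cong (allFin (suc N)) (λ j → trans (swap-Perm-head j) fixed) ⟩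
  ∑ (allFin (suc N)) (λ _ → N !)
    ≡⟨ ∑-const (allFin (suc N)) (N !) ⟩
  length (allFin (suc N)) * N !
    ≡⟨ cong (_* N !) (Listₚ.length-tabulate {n = suc N} id) ⟩
  suc N * N ! ∎
  where
  open ≡-Reasoning
  fixed : count (λ σ → Perm? σ ×-dec (lookup σ zero Fin.≟ zero)) (Maps (suc N)) ≡ N !
  fixed = trans (count-fixing-first {N} Perm? Perm? id (λ {σ} p → ⊕-Perm id₁ σ id₁-Perm p) (λ {σ} p → ⊕-Perm⁻ id₁ σ p))
                (count-Perm N)

iter-+ : ∀ {N} (σ : Vec (Fin N) N) s t i → iter σ (s + t) i ≡ iter σ s (iter σ t i)
iter-+ σ zero    t i = refl
iter-+ σ (suc s) t i = cong (lookup σ) (iter-+ σ s t i)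

iter-lookup : ∀ {N} (σ : Vec (Fin N) N) t i → iter σ t (lookup σ i) ≡ lookup σ (iter σ t i)
iter-lookup σ zero    i = refl
iter-lookup σ (suc t) i = cong (lookup σ) (iter-lookup σ t i)

iter-injective : ∀ {N} {σ : Vec (Fin N) N} → Perm σ → ∀ t {i j} → iter σ t i ≡ iter σ t j → i ≡ j
iter-injective p zero    eq = eq
iter-injective p (suc t) eq = iter-injective p t (injective p eq)

inKCycle-iter : ∀ {N k} {σ : Vec (Fin N) N} → Perm σ → ∀ {i} → InKCycle k σ i → ∀ t → InKCycle k σ (iter σ t i)
inKCycle-iter p inK zero    = inK
inKCycle-iter {k = k} {σ} p inK (suc t) with inKCycle-iter p inK t
... | inCycle ret min = inCycle (trans (iter-lookup σ k _) (cong (lookup σ) ret))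
  λ {s} s<k eq → min s<k (injective p (trans (sym (iter-lookup σ (suc s) _)) eq))

next : ∀ {k} → Fin (suc k) → Fin (suc k)
next {k} i with suc (toℕ i) ℕ.<? suc k
... | yes si<k = Fin.fromℕ< si<k
... | no  _    = zero

toℕ-next : ∀ {k} {i : Fin (suc k)} → suc (toℕ i) < suc k → toℕ (next i) ≡ suc (toℕ i)
toℕ-next {k} {i} si<k with suc (toℕ i) ℕ.<? suc k
... | yes p = Finₚ.toℕ-fromℕ< p
... | no ¬p = contradiction si<k ¬p

next-last : ∀ {k} {i : Fin (suc k)} → toℕ i ≡ k → next i ≡ zero
next-last {k} {i} eq with suc (toℕ i) ℕ.<? suc k
... | yes p = contradiction (cong suc eq) (ℕₚ.<⇒≢ p)
... | no _  = refl

rot : ∀ k → Vec (Fin (suc k)) (suc k)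
rot k = tabulate next

lookup-rot : ∀ k i → lookup (rot k) i ≡ next i
lookup-rot k = Vecₚ.lookup∘tabulate next

inner-or-last : ∀ {k} (i : Fin (suc k)) → suc (toℕ i) < suc k ⊎ toℕ i ≡ k
inner-or-last {k} i with ℕₚ.m≤n⇒m<n∨m≡n (ℕₚ.≤-pred (Finₚ.toℕ<n i))
... | inj₁ i<k = inj₁ (s≤s i<k)
... | inj₂ i≡k = inj₂ i≡k

rot-Perm : ∀ k → Perm (rot k)
rot-Perm k = perm λ {i} {j} eq → next-injective (inner-or-last i) (inner-or-last j)
  (trans (sym (lookup-rot k i)) (trans eq (lookup-rot k j)))
  where
  next-injective : ∀ {i j : Fin (suc k)} → suc (toℕ i) < suc k ⊎ toℕ i ≡ k → suc (toℕ j) < suc k ⊎ toℕ j ≡ k →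
                   next i ≡ next j → i ≡ j
  next-injective (inj₁ p) (inj₁ q) eq =
    Finₚ.toℕ-injective (ℕₚ.suc-injective (trans (sym (toℕ-next p)) (trans (cong toℕ eq) (toℕ-next q))))
  next-injective (inj₁ p) (inj₂ q) eq with trans (sym (toℕ-next p)) (cong toℕ (trans eq (next-last q)))
  ... | ()
  next-injective (inj₂ p) (inj₁ q) eq with trans (sym (toℕ-next q)) (cong toℕ (trans (sym eq) (next-last p)))
  ... | ()
  next-injective (inj₂ p) (inj₂ q) eq = Finₚ.toℕ-injective (trans p (sym q))

rot-surjective : ∀ {k} i → ∃ λ j → lookup (rot k) j ≡ i
rot-surjective {k} zero    = Fin.fromℕ k , trans (lookup-rot k _) (next-last (Finₚ.toℕ-fromℕ k))
rot-surjective {suc k} (suc i) = Fin.inject₁ i , trans (lookup-rot (suc k) (Fin.inject₁ i)) (Finₚ.toℕ-injective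
  (trans (toℕ-next {i = Fin.inject₁ i} (s≤s (subst (_< suc k) (sym (Finₚ.toℕ-inject₁ i)) (Finₚ.toℕ<n i)))) (cong suc (Finₚ.toℕ-inject₁ i))))

toℕ-iter-rot : ∀ k t → t < suc k → toℕ (iter (rot k) t zero) ≡ t
toℕ-iter-rot k zero    _    = refl
toℕ-iter-rot k (suc t) st<k = trans (cong toℕ (lookup-rot k _))
  (trans (toℕ-next (subst (λ s → suc s < suc k) (sym ih) st<k)) (cong suc ih))
  where
  ih : toℕ (iter (rot k) t zero) ≡ t
  ih = toℕ-iter-rot k t (ℕₚ.<-trans (ℕₚ.n<1+n t) st<k)

-- Only the orbit of `zero` is computed: `i` is its iterate number `toℕ i`, and lying on a cycle of
-- given length passes along the orbit.
rot-inKCycle : ∀ k i → InKCycle (suc k) (rot k) i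
rot-inKCycle k i = subst (InKCycle (suc k) (rot k)) (Finₚ.toℕ-injective (toℕ-iter-rot k (toℕ i) (Finₚ.toℕ<n i)))
  (inKCycle-iter (rot-Perm k) first (toℕ i))
  where
  first : InKCycle (suc k) (rot k) zero
  first = inCycle (trans (lookup-rot k _) (next-last (toℕ-iter-rot k k ℕₚ.≤-refl)))
    λ {t} st<k eq → ℕₚ.0≢1+n (trans (sym (cong toℕ eq)) (toℕ-iter-rot k (suc t) st<k))

kCyclePoints-rot : ∀ k → kCyclePoints (suc k) (rot k) ≡ suc k
kCyclePoints-rot k = trans
  (cong length (Listₚ.filter-all (T? ∘ inKCycle (suc k) (rot k)) {xs = allFin (suc k)}
    (All.tabulate λ {i} _ → inKCycle⁺ (suc k) (rot-inKCycle k i))))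
  (Listₚ.length-tabulate {n = suc k} id)

-- A fixed point returns too early for a cycle of length above 1. Consequently removing a fixed
-- first point does not change the number of k-cycles.
kCyclePoints-id₁ : ∀ {k} → 1 < k → kCyclePoints k id₁ ≡ 0
kCyclePoints-id₁ {k} 1<k = count-none (T? ∘ inKCycle k id₁) (allFin 1)
  λ { {zero} inK → minimal (inKCycle⁻ k inK) 1<k refl }

-- Points on k-cycles are counted here instead of the cycles: their number adds up over blocks, and
-- points can be marked one at a time.
WithPoints : ∀ {N} → ℕ → ℕ → Vec (Fin N) N → Set
WithPoints k c σ = Perm σ × kCyclePoints k σ ≡ c

WithPoints? : ∀ {N} k c → Decidable (WithPoints {N} k c)
WithPoints? k c σ = Perm? σ ×-dec (kCyclePoints k σ ℕ.≟ c)

-- The cycle of 0 has length `k` and begins 0, 1, ..., l-1. The record interpolates between a cycle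
-- marked at 0 (`l = 1`) and the standard cycle on the first `k` points (`l = k`).
record Path {N} (k c l : ℕ) (σ : Vec (Fin (suc N)) (suc N)) : Set where
  constructor path
  field
    isPath   : WithPoints k c σ
    in-cycle : InKCycle k σ zero
    ascends  : ∀ {t} → t < l → toℕ (iter σ t zero) ≡ t

open Path

Path? : ∀ {N} k c l → Decidable (Path {N} k c l)
Path? {N} k c l σ = map′ to from
  (WithPoints? k c σ ×-dec InKCycle? k σ zero ×-dec ℕₚ.allUpTo? (λ t → toℕ (iter σ t zero) ℕ.≟ t) l)
  where
  Fields : Set
  Fields = WithPoints k c σ × InKCycle k σ zero × (∀ {t} → t < l → toℕ (iter σ t zero) ≡ t)
  to : Fields → Path k c l σ
  to (w , i , a) = path w i a
  from : Path k c l σ → Fields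
  from (path w i a) = w , i , a

sum-upper : ∀ {n} l {e} {f : Fin n → ℕ} → (∀ j → toℕ j < l → f j ≡ 0) → (∀ j → l ≤ toℕ j → f j ≡ e) →
            sum (List.tabulate f) ≡ (n ∸ l) * e
sum-upper {zero}  zero    lo hi = refl
sum-upper {zero}  (suc l) lo hi = refl
sum-upper {suc n} zero    lo hi = cong₂ _+_ (hi zero z≤n) (sum-upper {n} zero (λ _ ()) (λ j _ → hi (suc j) z≤n))
sum-upper {suc n} (suc l) lo hi = cong₂ _+_ (lo zero (s≤s z≤n))
  (sum-upper {n} l (λ j j<l → lo (suc j) (s≤s j<l)) (λ j l≤j → hi (suc j) (s≤s l≤j)))

∑-allFin : ∀ {n} (f : Fin n → ℕ) → ∑ (allFin n) f ≡ sum (List.tabulate f)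
∑-allFin f = cong sum (Listₚ.map-tabulate id f)

module ConjugationStable {N} {τ : Fin N → Fin N} (invol : ∀ i → τ (τ i) ≡ i) where
  open Conjugation {τ = τ} invol

  conj-WithPoints : ∀ k {c σ} → WithPoints k c σ → WithPoints k c (conj τ σ)
  conj-WithPoints k {c} {σ} (p , eq) = conj-Perm p , trans (kCyclePoints-conj k σ) eq

  conj-InKCycle : ∀ {k σ i} → InKCycle k σ i → InKCycle k (conj τ σ) (τ i)
  conj-InKCycle {k} {σ} {i} inK = inKCycle⁻ k (subst T (sym (inKCycle-conj k σ i)) (inKCycle⁺ k inK))

module _ {N : ℕ} (k c : ℕ) where

  -- Were the l-th iterate of 0 some j < l, it would equal the j-th iterate; cancelling j steps, 0
  -- would return after l - j < k steps, against minimality.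
  Path-leaves : ∀ {l} {σ : Vec (Fin (suc N)) (suc N)} → l < k → Path k c l σ → l ≤ toℕ (iter σ l zero)
  Path-leaves {l} {σ} l<k pth with toℕ (iter σ l zero) ℕ.<? l
  ... | no ¬p = ℕₚ.≮⇒≥ ¬p
  ... | yes j<l = contradiction period (minimal (in-cycle pth) (ℕₚ.≤-<-trans d≤l l<k))
    where
    j d : ℕ
    j = toℕ (iter σ l zero)
    d = l ∸ suc j
    l≡ : j + suc d ≡ l
    l≡ = trans (ℕₚ.+-suc j d) (ℕₚ.m+[n∸m]≡n j<l)
    d≤l : suc d ≤ l
    d≤l = subst (suc d ≤_) l≡ (ℕₚ.m≤n+m (suc d) j)
    period : iter σ (suc d) zero ≡ zero
    period = iter-injective (proj₁ (isPath pth)) j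
      (trans (sym (iter-+ σ j (suc d) zero)) (trans (cong (λ s → iter σ s zero) l≡)
        (Finₚ.toℕ-injective (sym (ascends pth j<l)))))

  -- Conjugation by the transposition (l j) carries paths with σ(l-1) = j to paths with σ(l-1) = l, and j ≥ l is the
  -- only restriction.
  count-Path-step : ∀ {l} → 0 < l → l < k → count (Path? {N} k c l) (Maps (suc N)) ≡
                    (suc N ∸ l) * count (Path? {N} k c (suc l)) (Maps (suc N))
  count-Path-step {l} 0<l l<k = begin
    count (Path? k c l) (Maps (suc N))
      ≡⟨ count-fibres (Path? k c l) Fin._≟_ (λ σ → iter σ l zero) (Maps (suc N)) (allFin⁺ (suc N)) (λ _ → ∈-allFin _) ⟩
    ∑ (allFin (suc N)) (λ j → count (λ σ → Path? k c l σ ×-dec (iter σ l zero Fin.≟ j)) (Maps (suc N)))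
      ≡⟨ ∑-allFin {suc N} _ ⟩
    sum (List.tabulate λ j → count (λ σ → Path? k c l σ ×-dec (iter σ l zero Fin.≟ j)) (Maps (suc N)))
      ≡⟨ sum-upper l (λ j j<l → count-none _ (Maps (suc N))
           λ { (pth , eq) → ℕₚ.<⇒≱ j<l (subst (λ x → l ≤ toℕ x) eq (Path-leaves l<k pth)) }) upper ⟩
    (suc N ∸ l) * count (Path? k c (suc l)) (Maps (suc N)) ∎
    where
    open ≡-Reasoning
    upper : ∀ j → l ≤ toℕ j → count (λ σ → Path? k c l σ ×-dec (iter σ l zero Fin.≟ j)) (Maps (suc N)) ≡
            count (Path? k c (suc l)) (Maps (suc N))
    upper j l≤j = count-conj _ _ to from
      where
      l<N : l < suc N
      l<N = ℕₚ.≤-<-trans l≤j (Finₚ.toℕ<n j)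
      L : Fin (suc N)
      L = Fin.fromℕ< l<N
      τ : Fin (suc N) → Fin (suc N)
      τ = transpose L j
      open Conjugation {τ = τ} (transpose-involutive L j) using (count-conj; iter-conj)
      open ConjugationStable {τ = τ} (transpose-involutive L j)
      τ-low : ∀ i → toℕ i < l → τ i ≡ i
      τ-low i i<l = transpose-other
        (λ eq → ℕₚ.<⇒≢ i<l (trans (cong toℕ eq) (Finₚ.toℕ-fromℕ< l<N)))
        (λ eq → ℕₚ.<⇒≱ i<l (subst (λ x → l ≤ toℕ x) (sym eq) l≤j))
      iter-τ : ∀ σ t → iter (conj τ σ) t zero ≡ τ (iter σ t zero)
      iter-τ σ t = trans (cong (iter (conj τ σ) t) (sym (τ-low zero 0<l))) (iter-conj σ t zero)
      conj-Path : ∀ {σ} → Path k c l σ → Path k c l (conj τ σ)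
      conj-Path {σ} (path w i a) = path (conj-WithPoints k w)
        (subst (InKCycle k (conj τ σ)) (τ-low zero 0<l) (conj-InKCycle i))
        λ {t} t<l → trans (cong toℕ (trans (iter-τ σ t) (τ-low _ (subst (_< l) (sym (a t<l)) t<l)))) (a t<l)
      to : ∀ {σ} → Path k c l σ × iter σ l zero ≡ j → Path k c (suc l) (conj τ σ)
      to {σ} (pth , eq) = path (isPath pth') (in-cycle pth') λ t≤l → extend (ℕₚ.m≤n⇒m<n∨m≡n (ℕₚ.≤-pred t≤l))
        where
        pth' : Path k c l (conj τ σ)
        pth' = conj-Path pth
        extend : ∀ {t} → t < l ⊎ t ≡ l → toℕ (iter (conj τ σ) t zero) ≡ t
        extend (inj₁ t<l) = ascends pth' t<l
        extend (inj₂ refl) = trans (cong toℕ (trans (iter-τ σ l) (trans (cong τ eq) (transpose-snd L j)))) (Finₚ.toℕ-fromℕ< l<N)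
      from : ∀ {σ} → Path k c (suc l) σ → Path k c l (conj τ σ) × iter (conj τ σ) l zero ≡ j
      from {σ} (path w i a) = conj-Path (path w i (λ t<l → a (ℕₚ.m≤n⇒m≤1+n t<l))) ,
        trans (iter-τ σ l) (trans (cong τ (Finₚ.toℕ-injective (trans (a ℕₚ.≤-refl) (sym (Finₚ.toℕ-fromℕ< l<N))))) (transpose-fst L j))

  -- Pairs of a permutation and a point on one of its k-cycles are counted in two ways. Each
  -- permutation has `c` such points; conversely, conjugation by the transposition of 0 and i moves
  -- the mark from i to 0. For `l = 1` the field `ascends` concerns `t = 0` only and holds
  -- trivially.
  count-marked : c * count (WithPoints? {suc N} k c) (Maps (suc N)) ≡ suc N * count (Path? {N} k c 1) (Maps (suc N))
  count-marked = begin
    c * count (WithPoints? k c) (Maps (suc N))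
      ≡⟨ ℕₚ.*-comm c _ ⟩
    count (WithPoints? k c) (Maps (suc N)) * c
      ≡⟨ ∑-const (filter (WithPoints? k c) (Maps (suc N))) c ⟨
    ∑ (filter (WithPoints? k c) (Maps (suc N))) (λ _ → c)
      ≡⟨ ∑-cong-∈ (filter (WithPoints? k c) (Maps (suc N))) (λ {σ} σ∈ → sym (points σ (proj₂ (proj₂ (∈-filter⁻ (WithPoints? k c) {xs = Maps (suc N)} σ∈))))) ⟩
    ∑ (filter (WithPoints? k c) (Maps (suc N))) (λ σ → ∑ (filter (InKCycle? k σ) (allFin (suc N))) (λ _ → 1))
      ≡⟨ ∑-double-count (WithPoints? k c) (InKCycle? k) (Maps (suc N)) (allFin (suc N)) (λ _ → 1) ⟩
    ∑ (allFin (suc N)) (λ i → count (λ σ → WithPoints? k c σ ×-dec InKCycle? k σ i) (Maps (suc N)) * 1)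
      ≡⟨ ∑-cong (allFin (suc N)) (λ i → trans (ℕₚ.*-identityʳ _) (at-zero i)) ⟩
    ∑ (allFin (suc N)) (λ _ → count (Path? k c 1) (Maps (suc N)))
      ≡⟨ ∑-const (allFin (suc N)) _ ⟩
    length (allFin (suc N)) * count (Path? k c 1) (Maps (suc N))
      ≡⟨ cong (_* count (Path? k c 1) (Maps (suc N))) (Listₚ.length-tabulate {n = suc N} id) ⟩
    suc N * count (Path? k c 1) (Maps (suc N)) ∎
    where
    open ≡-Reasoning
    points : ∀ (σ : Vec (Fin (suc N)) (suc N)) → kCyclePoints k σ ≡ c → ∑ (filter (InKCycle? k σ) (allFin (suc N))) (λ _ → 1) ≡ c
    points σ eq = trans (∑-const (filter (InKCycle? k σ) (allFin (suc N))) 1) (trans (ℕₚ.*-identityʳ _)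
      (trans (count-cong (InKCycle? k σ) (T? ∘ inKCycle k σ) (allFin (suc N)) (inKCycle⁺ k) (inKCycle⁻ k)) eq))
    at-zero : ∀ i → count (λ σ → WithPoints? k c σ ×-dec InKCycle? k σ i) (Maps (suc N)) ≡ count (Path? k c 1) (Maps (suc N))
    at-zero i = count-conj _ _
      (λ { {σ} (w , inK) → path (conj-WithPoints k w)
        (subst (InKCycle k (conj (transpose zero i) σ)) (transpose-snd zero i) (conj-InKCycle inK)) λ { {zero} _ → refl ; {suc t} (s≤s ()) } })
      (λ { {σ} (path w inK _) → conj-WithPoints k w ,
        subst (InKCycle k (conj (transpose zero i) σ)) (transpose-fst zero i) (conj-InKCycle inK) })
      where
      invol : ∀ x → transpose zero i (transpose zero i x) ≡ x
      invol = transpose-involutive zero i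
      open Conjugation {τ = transpose zero i} invol using (count-conj)
      open ConjugationStable {τ = transpose zero i} invol

-- The ascent fixes the values at all but the last point of the block; the return of the cycle to 0
-- supplies that one.
Path⇒Extends-rot : ∀ {k M c} {σ : Vec (Fin (suc k + M)) (suc k + M)} → Path (suc k) c (suc k) σ → Extends (rot k) σ
Path⇒Extends-rot {k} {M} {c} {σ} pth i = begin
  lookup σ (i ↑ˡ M)          ≡⟨ cong (lookup σ) (Finₚ.toℕ-injective (trans (Finₚ.toℕ-↑ˡ i M) (sym (ascends pth (Finₚ.toℕ<n i))))) ⟩
  iter σ (suc (toℕ i)) zero  ≡⟨ by-position (inner-or-last i) ⟩
  next i ↑ˡ M                ≡⟨ cong (_↑ˡ M) (lookup-rot k i) ⟨
  lookup (rot k) i ↑ˡ M      ∎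
  where
  open ≡-Reasoning
  by-position : suc (toℕ i) < suc k ⊎ toℕ i ≡ k → iter σ (suc (toℕ i)) zero ≡ next i ↑ˡ M
  by-position (inj₁ si<k) = Finₚ.toℕ-injective
    (trans (ascends pth si<k) (sym (trans (Finₚ.toℕ-↑ˡ (next i) M) (toℕ-next si<k))))
  by-position (inj₂ i≡k) = trans (cong (λ t → iter σ (suc t) zero) i≡k)
    (trans (returns (in-cycle pth)) (cong (_↑ˡ M) (sym (next-last i≡k))))

kCyclePoints-rot-⊕ : ∀ {k M} (σ : Vec (Fin M) M) → kCyclePoints (suc k) (rot k ⊕ σ) ≡ suc k + kCyclePoints (suc k) σ
kCyclePoints-rot-⊕ {k} σ = trans (kCyclePoints-⊕ (rot k) σ (suc k)) (cong (_+ kCyclePoints (suc k) σ) (kCyclePoints-rot k))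

count-Path-full : ∀ k M c → count (Path? {k + M} (suc k) (suc k + c) (suc k)) (Maps (suc k + M)) ≡
                  count (WithPoints? (suc k) c) (Maps M)
count-Path-full k M c = count-extensions {a = suc k} rot-surjective _ _ (λ pth → proj₁ (isPath pth) , Path⇒Extends-rot pth)
  (λ {σ} (p , eq) → path (⊕-Perm (rot k) σ (rot-Perm k) p , trans (kCyclePoints-rot-⊕ σ) (cong (_+_ (suc k)) eq))
    (inKCycle⁻ (suc k) (subst T (sym (inKCycle-intertwine {σ = rot k} {rot k ⊕ σ} (_↑ˡ M) (lookup-⊕ˡ (rot k) σ) (Finₚ.↑ˡ-injective M _ _) (suc k) zero))
      (inKCycle⁺ (suc k) (rot-inKCycle k zero))))
    λ {t} t<k → trans (cong toℕ (iter-intertwine {σ = rot k} {rot k ⊕ σ} (_↑ˡ M) (lookup-⊕ˡ (rot k) σ) t zero))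
      (trans (Finₚ.toℕ-↑ˡ _ M) (toℕ-iter-rot k t t<k)))
  (λ {σ} pth → ⊕-Perm⁻ (rot k) σ (proj₁ (isPath pth)) ,
    ℕₚ.+-cancelˡ-≡ (suc k) _ _ (trans (sym (kCyclePoints-rot-⊕ σ)) (proj₂ (isPath pth))))

count-positive : ∀ {A : Set} {P : A → Set} (P? : Decidable P) {xs : List A} {x} → x ∈ xs → P x → 0 < count P? xs
count-positive P? {xs} x∈ px = nonempty (∈-filter⁺ P? x∈ px)
  where
  nonempty : ∀ {ys} {y} → y ∈ ys → 0 < length ys
  nonempty (here _)  = s≤s z≤n
  nonempty (there _) = s≤s z≤n

-- Through this, a counting identity yields an actual permutation, as the divisibility argument
-- requires.
count-witness : ∀ {A : Set} {P : A → Set} (P? : Decidable P) (xs : List A) → count P? xs ≢ 0 → ∃ P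
count-witness {P = P} P? xs n≢0 = first (filter P? xs) refl
  where
  first : ∀ ys → filter P? xs ≡ ys → ∃ P
  first []       eq = contradiction (cong length eq) n≢0
  first (y ∷ ys) eq = y , proj₂ (∈-filter⁻ P? {xs = xs} (subst (y ∈_) (sym eq) (here refl)))

∸-factorial : ∀ {n l} → l < n → (n ∸ l) ! ≡ (n ∸ l) * (n ∸ suc l) !
∸-factorial {suc n} {zero}  _         = refl
∸-factorial {suc n} {suc l} (s≤s l<n) = ∸-factorial l<n

module _ (N k c : ℕ) where

  pathCount : ℕ → ℕ
  pathCount l = count (Path? {N} k c l) (Maps (suc N))

  -- Iterating the step from `l` to `k` produces the falling factorial (N+1-l)! / (N+1-k)!, whose
  -- denominator is kept on the left.
  pathCount-chain : ∀ d l → l + d ≡ k → 0 < l → k ≤ suc N →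
                    pathCount l * (suc N ∸ k) ! ≡ (suc N ∸ l) ! * pathCount k
  pathCount-chain zero    l eq 0<l k≤N rewrite ℕₚ.+-identityʳ l | eq = ℕₚ.*-comm (pathCount k) _
  pathCount-chain (suc d) l eq 0<l k≤N = begin
    pathCount l * (suc N ∸ k) !
      ≡⟨ cong (_* (suc N ∸ k) !) (count-Path-step {N} k c 0<l l<k) ⟩
    (suc N ∸ l) * pathCount (suc l) * (suc N ∸ k) !
      ≡⟨ ℕₚ.*-assoc (suc N ∸ l) _ _ ⟩
    (suc N ∸ l) * (pathCount (suc l) * (suc N ∸ k) !)
      ≡⟨ cong ((suc N ∸ l) *_) (pathCount-chain d (suc l) (trans (sym (ℕₚ.+-suc l d)) eq) (s≤s z≤n) k≤N) ⟩
    (suc N ∸ l) * ((suc N ∸ suc l) ! * pathCount k)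
      ≡⟨ ℕₚ.*-assoc (suc N ∸ l) _ _ ⟨
    (suc N ∸ l) * (suc N ∸ suc l) ! * pathCount k
      ≡⟨ cong (_* pathCount k) (∸-factorial (ℕₚ.≤-trans l<k k≤N)) ⟨
    (suc N ∸ l) ! * pathCount k ∎
    where
    open ≡-Reasoning
    l<k : l < k
    l<k = subst (l <_) eq (ℕₚ.m<m+n l (s≤s z≤n))

  -- A cycle longer than the number of points would let the path grow until it covers every point;
  -- there the step contributes the factor 0.
  pathCount-overlong : suc N < k → ∀ d l → l + d ≡ suc N → 0 < l → pathCount l ≡ 0
  pathCount-overlong N<k zero    l eq 0<l = trans (count-Path-step {N} k c 0<l (subst (_< k) (sym l≡N) N<k))
    (cong (_* pathCount (suc l)) (trans (cong (suc N ∸_) l≡N) (ℕₚ.n∸n≡0 (suc N))))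
    where
    l≡N : l ≡ suc N
    l≡N = trans (sym (ℕₚ.+-identityʳ l)) eq
  pathCount-overlong N<k (suc d) l eq 0<l = trans
    (count-Path-step {N} k c 0<l (ℕₚ.≤-<-trans (subst (l ≤_) eq (ℕₚ.m≤m+n l (suc d))) N<k))
    (trans (cong ((suc N ∸ l) *_) (pathCount-overlong N<k d (suc l) (trans (sym (ℕₚ.+-suc l d)) eq) (s≤s z≤n)))
           (ℕₚ.*-zeroʳ (suc N ∸ l)))

module _ (k : ℕ) where

  -- No orbit decomposition is needed: a permutation with k-cycle points gives, through the counting identities,
  -- one whose first k points form the standard cycle, and that cycle can be split off.
  kCyclePoints-divisible : ∀ N (σ : Vec (Fin N) N) → Perm σ → suc k ∣ kCyclePoints (suc k) σ
  kCyclePoints-divisible = <-rec _ go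
    where
    go : ∀ N → (∀ {M} → M < N → (σ : Vec (Fin M) M) → Perm σ → suc k ∣ kCyclePoints (suc k) σ) →
         (σ : Vec (Fin N) N) → Perm σ → suc k ∣ kCyclePoints (suc k) σ
    go zero    rec σ p = divides 0 refl
    go (suc N) rec σ p = by-value (kCyclePoints (suc k) σ) refl
      where
      split : ∀ M → N ≡ k + M → ∀ c → pathCount N (suc k) c (suc k) ≢ 0 → suc k ∣ c
      split M refl c nonzero = subst (suc k ∣_) points (∣m∣n⇒∣m+n ∣-refl (rec (s≤s (ℕₚ.m≤n+m M k)) σ' p'))
        where
        witness : ∃ (Path {k + M} (suc k) c (suc k))
        witness = count-witness (Path? (suc k) c (suc k)) (Maps (suc k + M)) nonzero
        σ₁ : Vec (Fin (suc k + M)) (suc k + M)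
        σ₁ = proj₁ witness
        σ' : Vec (Fin M) M
        σ' = restrictʳ (suc k) σ₁
        rebuild : rot k ⊕ σ' ≡ σ₁
        rebuild = ⊕-restrictʳ rot-surjective (proj₁ (isPath (proj₂ witness))) (Path⇒Extends-rot (proj₂ witness))
        p' : Perm σ'
        p' = ⊕-Perm⁻ (rot k) σ' (subst Perm (sym rebuild) (proj₁ (isPath (proj₂ witness))))
        points : suc k + kCyclePoints (suc k) σ' ≡ c
        points = trans (sym (kCyclePoints-rot-⊕ σ'))
          (trans (cong (kCyclePoints (suc k)) rebuild) (proj₂ (isPath (proj₂ witness))))
      by-value : ∀ c → kCyclePoints (suc k) σ ≡ c → suc k ∣ c
      by-value zero    eq = divides 0 refl
      by-value (suc c) eq = by-size (suc k ℕ.≤? suc N)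
        where
        started : pathCount N (suc k) (suc c) 1 ≢ 0
        started none = ℕₚ.<⇒≢ (count-positive (WithPoints? (suc k) (suc c)) (Maps-complete σ) (p , eq))
          (sym (ℕₚ.m*n≡0⇒m≡0 _ (suc c) (trans (ℕₚ.*-comm _ (suc c))
            (trans (count-marked {N} (suc k) (suc c)) (trans (cong (suc N *_) none) (ℕₚ.*-zeroʳ (suc N)))))))
        by-size : Dec (suc k ≤ suc N) → suc k ∣ suc c
        by-size (yes (s≤s k≤N)) = split (N ∸ k) (sym (ℕₚ.m+[n∸m]≡n k≤N)) (suc c) λ none → started
          (ℕₚ.m*n≡0⇒m≡0 _ ((N ∸ k) !) {{ℕₚ._!≢0 (N ∸ k)}}
            (trans (pathCount-chain N (suc k) (suc c) k 1 refl (s≤s z≤n) (s≤s k≤N))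
              (trans (cong (N ! *_) none) (ℕₚ.*-zeroʳ (N !)))))
        by-size (no k≰N) = contradiction (pathCount-overlong N (suc k) (suc c) (ℕₚ.≰⇒> k≰N) N 1 refl (s≤s z≤n)) started

-- The recursion for permutations with a given number of k-cycles

WithCycles : ∀ {N} → ℕ → ℕ → Vec (Fin N) N → Set
WithCycles k m σ = Perm σ × numKCycles k σ ≡ m

WithCycles? : ∀ {N} k m → Decidable (WithCycles {N} k m)
WithCycles? k m σ = Perm? σ ×-dec (numKCycles k σ ℕ.≟ m)

cycleCount : (k N m : ℕ) → ℕ
cycleCount k N m = count (WithCycles? {N} k m) (Maps N)

PermsWithKCycles≡filter : ∀ k N m → PermsWithKCycles k N m ≡ filter (WithCycles? k m) (Maps N)
PermsWithKCycles≡filter k N m = trans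
  (filter-filter (T? ∘ isPerm) (λ σ → T? (numKCycles k σ ℕ.≡ᵇ m)) (Maps N))
  (Listₚ.filter-≐ _ (WithCycles? k m)
    ((λ (p , eq) → isPerm⇒Perm p , ℕₚ.≡ᵇ⇒≡ _ _ eq) , (λ (p , eq) → Perm⇒isPerm p , ℕₚ.≡⇒≡ᵇ _ _ eq)) (Maps N))

-- By divisibility the truncated quotient in `numKCycles` has no remainder, so m cycles mean exactly
-- `m * suc k` points.
cycleCount-points : ∀ k N m → cycleCount (suc k) N m ≡ count (WithPoints? (suc k) (m * suc k)) (Maps N)
cycleCount-points k N m = count-cong _ _ (Maps N)
  (λ {σ} (p , eq) → p , to (kCyclePoints-divisible k N σ p) eq)
  (λ {σ} (p , eq) → p , trans (cong (_/ suc k) eq) (m*n/n≡m m (suc k)))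
  where
  to : ∀ {c} → suc k ∣ c → c / suc k ≡ m → c ≡ m * suc k
  to (divides q refl) eq = cong (_* suc k) (trans (sym (m*n/n≡m q (suc k))) eq)

-- The factor `suc m * suc k` counts the possible marks. On the other side, moving the mark to 0
-- gives `suc k + M`, straightening the rest of the cycle gives (k+M)! / M!, and removing the
-- standard cycle leaves a permutation of `M` points with one cycle fewer.
cycleCount-suc : ∀ k M m → suc m * suc k * cycleCount (suc k) (suc k + M) (suc m) * M ! ≡
                 (suc k + M) ! * cycleCount (suc k) M m
cycleCount-suc k M m = begin
  c * cycleCount (suc k) N (suc m) * M !
    ≡⟨ cong (λ x → c * x * M !) (cycleCount-points k N (suc m)) ⟩
  c * count (WithPoints? (suc k) c) (Maps N) * M !
    ≡⟨ cong (_* M !) (count-marked {k + M} (suc k) c) ⟩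
  N * pathCount (k + M) (suc k) c 1 * M !
    ≡⟨ ℕₚ.*-assoc N (pathCount (k + M) (suc k) c 1) (M !) ⟩
  N * (pathCount (k + M) (suc k) c 1 * M !)
    ≡⟨ cong (λ x → N * (pathCount (k + M) (suc k) c 1 * x !)) (ℕₚ.m+n∸m≡n k M) ⟨
  N * (pathCount (k + M) (suc k) c 1 * (N ∸ suc k) !)
    ≡⟨ cong (N *_) (pathCount-chain (k + M) (suc k) c k 1 refl (s≤s z≤n) (s≤s (ℕₚ.m≤m+n k M))) ⟩
  N * ((k + M) ! * pathCount (k + M) (suc k) c (suc k))
    ≡⟨ ℕₚ.*-assoc N ((k + M) !) (pathCount (k + M) (suc k) c (suc k)) ⟨
  N ! * pathCount (k + M) (suc k) c (suc k)
    ≡⟨ cong (N ! *_) (trans (count-Path-full k M (m * suc k)) (sym (cycleCount-points k M m))) ⟩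
  N ! * cycleCount (suc k) M m ∎
  where
  open ≡-Reasoning
  N c : ℕ
  N = suc k + M
  c = suc m * suc k

numKCycles< : ∀ {k N R} (σ : Vec (Fin N) N) → N < R * suc k → numKCycles (suc k) σ < R
numKCycles< {k} {N} σ N<Rk = m<n*o⇒m/o<n (ℕₚ.≤-<-trans
  (ℕₚ.≤-trans (Listₚ.length-filter (T? ∘ inKCycle (suc k) σ) (allFin N)) (ℕₚ.≤-reflexive (Listₚ.length-tabulate {n = N} id))) N<Rk)

cycleCount-total : ∀ k N {R} → N < R * suc k → ∑ (upTo R) (cycleCount (suc k) N) ≡ N !
cycleCount-total k N {R} N<Rk = trans
  (sym (count-fibres Perm? ℕ._≟_ (numKCycles (suc k)) (Maps N) (upTo⁺ R) (λ {σ} _ → ∈-upTo⁺ (numKCycles< σ N<Rk))))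
  (count-Perm N)

-- The distribution of the value at the first point

startingAt : ∀ k N m → Fin (suc N) → ℕ
startingAt k N m j = count (λ σ → WithCycles? k m σ ×-dec (lookup σ zero Fin.≟ j)) (Maps (suc N))

startingAt-zero : ∀ {k} N m → 1 < k → startingAt k N m zero ≡ cycleCount k N m
startingAt-zero {k} N m 1<k = count-fixing-first {N} (WithCycles? k m) (WithCycles? k m) proj₁
  (λ {σ} (p , eq) → ⊕-Perm id₁ σ id₁-Perm p , trans (cycles σ) eq)
  (λ {σ} (p , eq) → ⊕-Perm⁻ id₁ σ p , trans (sym (cycles σ)) eq)
  where
  cycles : ∀ σ → numKCycles k (id₁ ⊕ σ) ≡ numKCycles k σ
  cycles σ = cong (λ c → divℕ c k) (trans (kCyclePoints-⊕ id₁ σ k) (cong (_+ kCyclePoints k σ) (kCyclePoints-id₁ 1<k)))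

-- The transposition of the two values moves neither of them to 0 and fixes 0 by computation, so
-- conjugation by it changes the value at 0 from one to the other.
startingAt-suc : ∀ k N m (i j : Fin N) → startingAt k N m (suc i) ≡ startingAt k N m (suc j)
startingAt-suc k N m i j = count-conj _ _
  (λ {σ} ((p , eq) , at) → (conj-Perm p , trans (cycles σ) eq) ,
    trans (iter-conj σ 1 zero) (trans (cong τ at) (transpose-fst (suc i) (suc j))))
  (λ {σ} ((p , eq) , at) → (conj-Perm p , trans (cycles σ) eq) ,
    trans (iter-conj σ 1 zero) (trans (cong τ at) (transpose-snd (suc i) (suc j))))
  where
  τ : Fin (suc N) → Fin (suc N)
  τ = transpose (suc i) (suc j)
  open Conjugation {τ = τ} (transpose-involutive (suc i) (suc j))
  cycles : ∀ σ → numKCycles k (conj τ σ) ≡ numKCycles k σ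
  cycles σ = cong (λ c → divℕ c k) (kCyclePoints-conj k σ)

sum-tabulate-const : ∀ n e {f : Fin n → ℕ} → (∀ j → f j ≡ e) → sum (List.tabulate f) ≡ n * e
sum-tabulate-const n e eq = sum-upper 0 (λ _ ()) (λ j _ → eq j)

-- This is the arithmetic series n (2s + n - 1) / 2, doubled, with the negative term moved to the
-- left so as to remain within the natural numbers.
2*sum-arithmetic : ∀ n s q {f : Fin n → ℕ} → (∀ j → f j ≡ q * (s + toℕ j)) →
                   2 * sum (List.tabulate f) + q * n ≡ q * (n * (2 * s + n))
2*sum-arithmetic zero    s q eq = trans (ℕₚ.*-zeroʳ q) (sym (ℕₚ.*-zeroʳ q))
2*sum-arithmetic (suc n) s q {f} eq = begin
  2 * (f zero + S) + q * suc n
    ≡⟨ cong (λ x → 2 * (x + S) + q * suc n) (eq zero) ⟩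
  2 * (q * (s + 0) + S) + q * suc n
    ≡⟨ regroup q s S n ⟩
  2 * (q * s) + q + (2 * S + q * n)
    ≡⟨ cong (_+_ (2 * (q * s) + q)) (2*sum-arithmetic n (suc s) q (λ j → trans (eq (suc j)) (cong (q *_) (ℕₚ.+-suc s (toℕ j))))) ⟩
  2 * (q * s) + q + q * (n * (2 * suc s + n))
    ≡⟨ expand q s n ⟩
  q * (suc n * (2 * s + suc n)) ∎
  where
  open ≡-Reasoning
  S : ℕ
  S = sum (List.tabulate (f ∘ suc))
  regroup : ∀ q s S n → 2 * (q * (s + 0) + S) + q * (1 + n) ≡ 2 * (q * s) + q + (2 * S + q * n)
  regroup = solve-∀
  expand : ∀ q s n → 2 * (q * s) + q + q * (n * (2 * (1 + s) + n)) ≡ q * ((1 + n) * (2 * s + (1 + n)))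
  expand = solve-∀

valAt1-lookup : ∀ {N} (σ : Vec (Fin (suc N)) (suc N)) → valAt1 σ ≡ suc (toℕ (lookup σ zero))
valAt1-lookup (x ∷ σ) = refl

module _ {k : ℕ} (N m : ℕ) (1<k : 1 < k) where

  private
    A p q : ℕ
    A = cycleCount k (2 + N) m
    p = cycleCount k (suc N) m
    -- The second point represents all values other than the first; the `2 + N` points ensure that
    -- it exists.
    q = startingAt k (suc N) m (suc zero)

  cycleCount-startingAt : A ≡ p + suc N * q
  cycleCount-startingAt = begin
    A
      ≡⟨ count-fibres (WithCycles? k m) Fin._≟_ (λ σ → lookup σ zero) (Maps (2 + N)) (allFin⁺ (2 + N)) (λ _ → ∈-allFin _) ⟩
    ∑ (allFin (2 + N)) (startingAt k (suc N) m)
      ≡⟨ ∑-allFin (startingAt k (suc N) m) ⟩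
    startingAt k (suc N) m zero + sum (List.tabulate (startingAt k (suc N) m ∘ suc))
      ≡⟨ cong₂ _+_ (startingAt-zero (suc N) m 1<k) (sum-tabulate-const (suc N) q λ j → startingAt-suc k (suc N) m j zero) ⟩
    p + suc N * q ∎
    where open ≡-Reasoning

  -- With n = 2 + N points this is 2 Σ = (n+1) A + (A - n p), without subtraction. The summand
  -- `q * suc N`, added on both sides in the proof, is the correction term of the doubled arithmetic
  -- series.
  ∑-valAt1 : 2 * ∑ (PermsWithKCycles k (2 + N) m) valAt1 + (2 + N) * p ≡ (4 + N) * A
  ∑-valAt1 = ℕₚ.+-cancelʳ-≡ (q * suc N) _ _ (begin
    2 * ∑ (PermsWithKCycles k (2 + N) m) valAt1 + (2 + N) * p + q * suc N
      ≡⟨ cong (λ x → 2 * x + (2 + N) * p + q * suc N) by-value ⟩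
    2 * (p * 1 + S) + (2 + N) * p + q * suc N
      ≡⟨ regroup p S N q ⟩
    (4 + N) * p + (2 * S + q * suc N)
      -- The series starts at s = 2, the smallest value of π(1) other than 1.
      ≡⟨ cong (_+_ ((4 + N) * p)) (2*sum-arithmetic (suc N) 2 q (λ j → cong (_* suc (toℕ (suc j))) (startingAt-suc k (suc N) m j zero))) ⟩
    (4 + N) * p + q * (suc N * (2 * 2 + suc N))
      ≡⟨ expand p N q ⟩
    (4 + N) * (p + suc N * q) + q * suc N
      ≡⟨ cong (λ x → (4 + N) * x + q * suc N) cycleCount-startingAt ⟨
    (4 + N) * A + q * suc N ∎)
    where
    open ≡-Reasoning
    S : ℕ
    S = sum (List.tabulate λ (j : Fin (suc N)) → startingAt k (suc N) m (suc j) * suc (toℕ (suc j)))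
    by-value : ∑ (PermsWithKCycles k (2 + N) m) valAt1 ≡ p * 1 + S
    by-value = begin
      ∑ (PermsWithKCycles k (2 + N) m) valAt1
        ≡⟨ cong (λ xs → ∑ xs valAt1) (PermsWithKCycles≡filter k (2 + N) m) ⟩
      ∑ (filter (WithCycles? k m) (Maps (2 + N))) valAt1
        ≡⟨ ∑-cong (filter (WithCycles? k m) (Maps (2 + N))) valAt1-lookup ⟩
      ∑ (filter (WithCycles? k m) (Maps (2 + N))) (λ σ → suc (toℕ (lookup σ zero)))
        ≡⟨ ∑-fibres (WithCycles? k m) Fin._≟_ (λ σ → lookup σ zero) (Maps (2 + N)) (allFin⁺ (2 + N)) (λ _ → ∈-allFin _) (suc ∘ toℕ) ⟩
      ∑ (allFin (2 + N)) (λ j → startingAt k (suc N) m j * suc (toℕ j))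
        ≡⟨ ∑-allFin (λ (j : Fin (2 + N)) → startingAt k (suc N) m j * suc (toℕ j)) ⟩
      startingAt k (suc N) m zero * 1 + S
        ≡⟨ cong (λ x → x * 1 + S) (startingAt-zero (suc N) m 1<k) ⟩
      p * 1 + S ∎
    regroup : ∀ p S N q → 2 * (p * 1 + S) + (2 + N) * p + q * (1 + N) ≡ (4 + N) * p + (2 * S + q * (1 + N))
    regroup = solve-∀
    expand : ∀ p N q → (4 + N) * p + q * ((1 + N) * (2 * 2 + (1 + N))) ≡ (4 + N) * (p + (1 + N) * q) + q * (1 + N)
    expand = solve-∀

-- Triangular arrays of integers

∑ᶻ : ℕ → (ℕ → ℤ) → ℤ
∑ᶻ zero    f = 0ℤ
∑ᶻ (suc n) f = f 0 +ᶻ ∑ᶻ n (f ∘ suc)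

∑ᶻ-cong : ∀ n {f g : ℕ → ℤ} → (∀ m → m < n → f m ≡ g m) → ∑ᶻ n f ≡ ∑ᶻ n g
∑ᶻ-cong zero    eq = refl
∑ᶻ-cong (suc n) eq = cong₂ _+ᶻ_ (eq 0 (s≤s z≤n)) (∑ᶻ-cong n λ m m<n → eq (suc m) (s≤s m<n))

∑ᶻ-linear : ∀ n a b (f g : ℕ → ℤ) → ∑ᶻ n (λ m → a *ᶻ f m +ᶻ b *ᶻ g m) ≡ a *ᶻ ∑ᶻ n f +ᶻ b *ᶻ ∑ᶻ n g
∑ᶻ-linear zero    a b f g = lemma a b
  where
  lemma : ∀ a b → 0ℤ ≡ a *ᶻ 0ℤ +ᶻ b *ᶻ 0ℤ
  lemma = solveℤ
∑ᶻ-linear (suc n) a b f g = trans (cong (a *ᶻ f 0 +ᶻ b *ᶻ g 0 +ᶻ_) (∑ᶻ-linear n a b (f ∘ suc) (g ∘ suc)))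
  (lemma a b (f 0) (g 0) (∑ᶻ n (f ∘ suc)) (∑ᶻ n (g ∘ suc)))
  where
  lemma : ∀ a b x y s t → a *ᶻ x +ᶻ b *ᶻ y +ᶻ (a *ᶻ s +ᶻ b *ᶻ t) ≡ a *ᶻ (x +ᶻ s) +ᶻ b *ᶻ (y +ᶻ t)
  lemma = solveℤ

∑ᶻ-*ˡ : ∀ n a (f : ℕ → ℤ) → ∑ᶻ n (λ m → a *ᶻ f m) ≡ a *ᶻ ∑ᶻ n f
∑ᶻ-*ˡ zero    a f = sym (ℤₚ.*-zeroʳ a)
∑ᶻ-*ˡ (suc n) a f = trans (cong (a *ᶻ f 0 +ᶻ_) (∑ᶻ-*ˡ n a (f ∘ suc))) (sym (ℤₚ.*-distribˡ-+ a (f 0) _))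

∑ᶻ-last : ∀ n f → ∑ᶻ (suc n) f ≡ ∑ᶻ n f +ᶻ f n
∑ᶻ-last zero    f = ℤₚ.+-comm (f 0) 0ℤ
∑ᶻ-last (suc n) f = trans (cong (f 0 +ᶻ_) (∑ᶻ-last n (f ∘ suc))) (sym (ℤₚ.+-assoc (f 0) _ _))

∑ᶻ-upTo : ∀ n (f : ℕ → ℕ) → + ∑ (upTo n) f ≡ ∑ᶻ n (+_ ∘ f)
∑ᶻ-upTo n f = go n id
  where
  go : ∀ n (g : ℕ → ℕ) → + ∑ (List.applyUpTo g n) f ≡ ∑ᶻ n (+_ ∘ f ∘ g)
  go zero    g = refl
  go (suc n) g = trans (ℤₚ.pos-+ (f (g 0)) _) (cong (_+ᶻ_ (+ f (g 0))) (go n (g ∘ suc)))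

-- V r m = (-1)^(r-m) C(r,m), through the Pascal rule.
V : ℕ → ℕ → ℤ
V zero    zero    = 1ℤ
V zero    (suc m) = 0ℤ
V (suc r) zero    = - V r zero
V (suc r) (suc m) = V r m -ᶻ V r (suc m)

V-beyond : ∀ {r m} → r < m → V r m ≡ 0ℤ
V-beyond {zero}  {suc m} _ = refl
V-beyond {suc r} {suc m} (s≤s r<m) = cong₂ _-ᶻ_ (V-beyond r<m) (V-beyond (ℕₚ.m≤n⇒m≤1+n r<m))

V-first : ∀ r → V r 0 ≡ (- (+ 1)) ^ r
V-first zero    = refl
V-first (suc r) = trans (cong -_ (V-first r)) (sym (ℤₚ.-1*i≡-i _))

V-first-unit : ∀ r → ∣ V r 0 ∣ ≡ 1
V-first-unit zero    = refl
V-first-unit (suc r) = trans (ℤₚ.∣-i∣≡∣i∣ (V r 0)) (V-first-unit r)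

-- Absorption for binomial coefficients: the sign depends only on r - m, so it is the same on both
-- sides. The rescaled k-cycle recursion takes exactly this form.
V-absorb : ∀ r m → + suc m *ᶻ V (suc r) (suc m) ≡ + suc r *ᶻ V r m
V-absorb zero    zero    = refl
V-absorb zero    (suc m) = ℤₚ.*-zeroʳ (+ suc (suc m))
V-absorb (suc r) zero    = begin
  + 1 *ᶻ (- V r 0 -ᶻ V (suc r) 1)            ≡⟨ cong (λ x → + 1 *ᶻ (- V r 0 -ᶻ x)) step ⟩
  + 1 *ᶻ (- V r 0 -ᶻ (+ suc r *ᶻ V r 0))    ≡⟨ lemma (V r 0) (+ suc r) ⟩
  (+ 1 +ᶻ + suc r) *ᶻ - V r 0                ∎
  where
  open ≡-Reasoning
  step : V (suc r) 1 ≡ + suc r *ᶻ V r 0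
  step = trans (sym (ℤₚ.*-identityˡ _)) (V-absorb r zero)
  lemma : ∀ v c → + 1 *ᶻ (- v -ᶻ (c *ᶻ v)) ≡ (+ 1 +ᶻ c) *ᶻ - v
  lemma = solveℤ
V-absorb (suc r) (suc m) = begin
  (+ 1 +ᶻ + suc m) *ᶻ (x -ᶻ y)                          ≡⟨ expand (+ suc m) x y ⟩
  + suc m *ᶻ x +ᶻ x -ᶻ (+ 1 +ᶻ + suc m) *ᶻ y          ≡⟨ cong₂ (λ s t → s +ᶻ x -ᶻ t) (V-absorb r m) (V-absorb r (suc m)) ⟩
  + suc r *ᶻ V r m +ᶻ x -ᶻ + suc r *ᶻ V r (suc m)      ≡⟨ collect (+ suc r) (V r m) (V r (suc m)) ⟩
  (+ 1 +ᶻ + suc r) *ᶻ x                                  ∎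
  where
  open ≡-Reasoning
  x y : ℤ
  x = V (suc r) (suc m)
  y = V (suc r) (suc (suc m))
  expand : ∀ c x y → (+ 1 +ᶻ c) *ᶻ (x -ᶻ y) ≡ c *ᶻ x +ᶻ x -ᶻ (+ 1 +ᶻ c) *ᶻ y
  expand = solveℤ
  collect : ∀ c v w → c *ᶻ v +ᶻ (v -ᶻ w) -ᶻ c *ᶻ w ≡ (+ 1 +ᶻ c) *ᶻ (v -ᶻ w)
  collect = solveℤ

-- The expansion of (1 - 1)^(r+1): by the Pascal rule the sum is that of row `r` minus itself, as
-- the extra entry `V r (suc r)` vanishes.
V-total : ∀ r → ∑ᶻ (suc (suc r)) (V (suc r)) ≡ 0ℤ
V-total r = begin
  - V r 0 +ᶻ ∑ᶻ (suc r) (λ m → V r m -ᶻ V r (suc m))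
    ≡⟨ cong (- V r 0 +ᶻ_) (∑ᶻ-cong (suc r) λ m _ → unit (V r m) (V r (suc m))) ⟩
  - V r 0 +ᶻ ∑ᶻ (suc r) (λ m → + 1 *ᶻ V r m +ᶻ -1ℤ *ᶻ V r (suc m))
    ≡⟨ cong (- V r 0 +ᶻ_) (∑ᶻ-linear (suc r) (+ 1) -1ℤ (V r) (V r ∘ suc)) ⟩
  - V r 0 +ᶻ (+ 1 *ᶻ ∑ᶻ (suc r) (V r) +ᶻ -1ℤ *ᶻ ∑ᶻ (suc r) (V r ∘ suc))
    ≡⟨ regroup (V r 0) (∑ᶻ (suc r) (V r)) (∑ᶻ (suc r) (V r ∘ suc)) ⟩
  ∑ᶻ (suc r) (V r) -ᶻ ∑ᶻ (suc (suc r)) (V r)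
    ≡⟨ cong (∑ᶻ (suc r) (V r) -ᶻ_) (trans (∑ᶻ-last (suc r) (V r)) (trans (cong (∑ᶻ (suc r) (V r) +ᶻ_) (V-beyond (ℕₚ.n<1+n r))) (ℤₚ.+-identityʳ _))) ⟩
  ∑ᶻ (suc r) (V r) -ᶻ ∑ᶻ (suc r) (V r)
    ≡⟨ ℤₚ.+-inverseʳ (∑ᶻ (suc r) (V r)) ⟩
  0ℤ ∎
  where
  open ≡-Reasoning
  unit : ∀ v w → v -ᶻ w ≡ + 1 *ᶻ v +ᶻ -1ℤ *ᶻ w
  unit = solveℤ
  regroup : ∀ v s t → - v +ᶻ (+ 1 *ᶻ s +ᶻ -1ℤ *ᶻ t) ≡ s -ᶻ (v +ᶻ t)
  regroup = solveℤ

-- B k r m counts the elements of (ℤ/k) ≀ S_r with exactly m points i such that σ(i) = i and x_i = 0.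
B : ℕ → ℕ → ℕ → ℤ
B k zero    zero    = 1ℤ
B k zero    (suc m) = 0ℤ
B k (suc r) m       = + k *ᶻ + suc r *ᶻ B k r m +ᶻ V (suc r) m

module _ (k : ℕ) where

  B-beyond : ∀ {r m} → r < m → B k r m ≡ 0ℤ
  B-beyond {zero}  {suc m} _   = refl
  B-beyond {suc r} {m}     r<m = cong₂ _+ᶻ_
    (trans (cong (+ k *ᶻ + suc r *ᶻ_) (B-beyond (ℕₚ.<-trans (ℕₚ.n<1+n r) r<m))) (ℤₚ.*-zeroʳ (+ k *ᶻ + suc r)))
    (V-beyond r<m)

  -- It reflects B(r,m) = C(r,m) B(r-m,0): choose the m points fixed with label 0, then derange the
  -- others. The proof needs no such choice, because both terms of the recursion for `B` absorb in
  -- the same way.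
  B-absorb : ∀ r m → + suc m *ᶻ B k (suc r) (suc m) ≡ + suc r *ᶻ B k r m
  B-absorb zero m = begin
    + suc m *ᶻ (+ k *ᶻ + 1 *ᶻ 0ℤ +ᶻ V 1 (suc m))  ≡⟨ lemma (+ suc m) (+ k) (V 1 (suc m)) ⟩
    + suc m *ᶻ V 1 (suc m)                               ≡⟨ V-absorb zero m ⟩
    + 1 *ᶻ V zero m                                      ≡⟨ cong (+ 1 *ᶻ_) (base m) ⟩
    + 1 *ᶻ B k zero m                                    ∎
    where
    open ≡-Reasoning
    lemma : ∀ c k v → c *ᶻ (k *ᶻ + 1 *ᶻ 0ℤ +ᶻ v) ≡ c *ᶻ v
    lemma = solveℤ
    base : ∀ m → V zero m ≡ B k zero m
    base zero    = refl
    base (suc m) = refl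
  B-absorb (suc r) m = begin
    + suc m *ᶻ (+ k *ᶻ R *ᶻ B k (suc r) (suc m) +ᶻ V (suc (suc r)) (suc m))
      ≡⟨ distribute (+ suc m) (+ k) R (B k (suc r) (suc m)) (V (suc (suc r)) (suc m)) ⟩
    + k *ᶻ R *ᶻ (+ suc m *ᶻ B k (suc r) (suc m)) +ᶻ + suc m *ᶻ V (suc (suc r)) (suc m)
      ≡⟨ cong₂ (λ x y → + k *ᶻ R *ᶻ x +ᶻ y) (B-absorb r m) (V-absorb (suc r) m) ⟩
    + k *ᶻ R *ᶻ (+ suc r *ᶻ B k r m) +ᶻ R *ᶻ V (suc r) m
      ≡⟨ collect (+ k) R (+ suc r) (B k r m) (V (suc r) m) ⟩
    R *ᶻ (+ k *ᶻ + suc r *ᶻ B k r m +ᶻ V (suc r) m) ∎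
    where
    open ≡-Reasoning
    R : ℤ
    R = + suc (suc r)
    distribute : ∀ c k r b v → c *ᶻ (k *ᶻ r *ᶻ b +ᶻ v) ≡ k *ᶻ r *ᶻ (c *ᶻ b) +ᶻ c *ᶻ v
    distribute = solveℤ
    collect : ∀ k r s b v → k *ᶻ r *ᶻ (s *ᶻ b) +ᶻ r *ᶻ v ≡ r *ᶻ (k *ᶻ s *ᶻ b +ᶻ v)
    collect = solveℤ

  -- The rows of `V` with positive index sum to zero, so only the factor k (r+1) survives at each
  -- step. The result is the order of S(k,r).
  B-total : ∀ r → ∑ᶻ (suc r) (B k r) ≡ + (r ! * k ℕ.^ r)
  B-total zero    = refl
  B-total (suc r) = begin
    ∑ᶻ (suc (suc r)) (B k (suc r))
      ≡⟨ ∑ᶻ-cong (suc (suc r)) (λ m _ → cong (+ k *ᶻ + suc r *ᶻ B k r m +ᶻ_) (sym (ℤₚ.*-identityˡ (V (suc r) m)))) ⟩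
    ∑ᶻ (suc (suc r)) (λ m → + k *ᶻ + suc r *ᶻ B k r m +ᶻ + 1 *ᶻ V (suc r) m)
      ≡⟨ ∑ᶻ-linear (suc (suc r)) (+ k *ᶻ + suc r) (+ 1) (B k r) (V (suc r)) ⟩
    + k *ᶻ + suc r *ᶻ ∑ᶻ (suc (suc r)) (B k r) +ᶻ + 1 *ᶻ ∑ᶻ (suc (suc r)) (V (suc r))
      ≡⟨ cong₂ (λ x y → + k *ᶻ + suc r *ᶻ x +ᶻ + 1 *ᶻ y) row (V-total r) ⟩
    + k *ᶻ + suc r *ᶻ + (r ! * k ℕ.^ r) +ᶻ 0ℤ
      ≡⟨ ℤₚ.+-identityʳ _ ⟩
    + k *ᶻ + suc r *ᶻ + (r ! * k ℕ.^ r)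
      ≡⟨ cong (_*ᶻ + (r ! * k ℕ.^ r)) (ℤₚ.pos-* k (suc r)) ⟨
    + (k * suc r) *ᶻ + (r ! * k ℕ.^ r)
      ≡⟨ ℤₚ.pos-* (k * suc r) (r ! * k ℕ.^ r) ⟨
    + (k * suc r * (r ! * k ℕ.^ r))
      ≡⟨ cong +_ (reorder k r (r !) (k ℕ.^ r)) ⟩
    + (suc r ! * k ℕ.^ suc r) ∎
    where
    open ≡-Reasoning
    row : ∑ᶻ (suc (suc r)) (B k r) ≡ + (r ! * k ℕ.^ r)
    row = trans (∑ᶻ-last (suc r) (B k r)) (trans (cong₂ _+ᶻ_ (B-total r) (B-beyond (ℕₚ.n<1+n r))) (ℤₚ.+-identityʳ _))
    reorder : ∀ k r f p → k * (1 + r) * (f * p) ≡ (1 + r) * f * (k * p)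
    reorder = solve-∀

  -- Both quotients, V(m+s,m) / V(s,0) and B(m+s,m) / B(s,0), equal C(m+s,m), since both arrays obey
  -- the same absorption rule. This is where the binomial coefficient cancels from U / A.
  V-B-ratio : ∀ m s → V (m + s) m *ᶻ B k s 0 ≡ V s 0 *ᶻ B k (m + s) m
  V-B-ratio zero    s = refl
  V-B-ratio (suc m) s = ℤₚ.*-cancelˡ-≡ (+ suc m) _ _ (begin
    + suc m *ᶻ (V (suc m + s) (suc m) *ᶻ B k s 0)  ≡⟨ ℤₚ.*-assoc (+ suc m) (V (suc m + s) (suc m)) (B k s 0) ⟨
    + suc m *ᶻ V (suc m + s) (suc m) *ᶻ B k s 0    ≡⟨ cong (_*ᶻ B k s 0) (V-absorb (m + s) m) ⟩
    + suc (m + s) *ᶻ V (m + s) m *ᶻ B k s 0        ≡⟨ ℤₚ.*-assoc (+ suc (m + s)) (V (m + s) m) (B k s 0) ⟩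
    + suc (m + s) *ᶻ (V (m + s) m *ᶻ B k s 0)      ≡⟨ cong (+ suc (m + s) *ᶻ_) (V-B-ratio m s) ⟩
    + suc (m + s) *ᶻ (V s 0 *ᶻ B k (m + s) m)      ≡⟨ rotate (+ suc (m + s)) (V s 0) (B k (m + s) m) ⟩
    V s 0 *ᶻ (+ suc (m + s) *ᶻ B k (m + s) m)      ≡⟨ cong (V s 0 *ᶻ_) (B-absorb (m + s) m) ⟨
    V s 0 *ᶻ (+ suc m *ᶻ B k (suc m + s) (suc m))  ≡⟨ rotate (V s 0) (+ suc m) (B k (suc m + s) (suc m)) ⟩
    + suc m *ᶻ (V s 0 *ᶻ B k (suc m + s) (suc m))  ∎)
    where
    open ≡-Reasoning
    rotate : ∀ x y z → x *ᶻ (y *ᶻ z) ≡ y *ᶻ (x *ᶻ z)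
    rotate = solveℤ

  B-nonzero : ∀ m s → B k s 0 ≢ 0ℤ → B k (m + s) m ≢ 0ℤ
  B-nonzero zero    s B≢0 = B≢0
  B-nonzero (suc m) s B≢0 eq = B-nonzero m s B≢0 (ℤₚ.*-cancelˡ-≡ (+ suc (m + s)) _ _
    (trans (sym (B-absorb (m + s) m)) (trans (cong (+ suc m *ᶻ_) eq) (trans (ℤₚ.*-zeroʳ (+ suc m)) (sym (ℤₚ.*-zeroʳ (+ suc (m + s))))))))

-- The recursion determines every entry but the first of row r + 1 from row r, and the row sum gives the first.
triangle-unique : (c d : ℕ → ℕ) → (∀ r → ℕ.NonZero (c r)) → (X Y : ℕ → ℕ → ℤ) →
  (∀ r m → m ≤ r → + suc m *ᶻ X (suc r) (suc m) *ᶻ + c r ≡ + d r *ᶻ X r m) →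
  (∀ r m → m ≤ r → + suc m *ᶻ Y (suc r) (suc m) *ᶻ + c r ≡ + d r *ᶻ Y r m) →
  (∀ r → ∑ᶻ (suc r) (X r) ≡ ∑ᶻ (suc r) (Y r)) → ∀ r m → m ≤ r → X r m ≡ Y r m
triangle-unique c d c≢0 X Y recX recY totals = go
  where
  cancel-last : ∀ x y {z} → x +ᶻ z ≡ y +ᶻ z → x ≡ y
  cancel-last x y {z} eq = trans (sym (strip x z)) (trans (cong (_-ᶻ z) eq) (strip y z))
    where
    strip : ∀ x z → x +ᶻ z -ᶻ z ≡ x
    strip = solveℤ
  go : ∀ r m → m ≤ r → X r m ≡ Y r m
  later : ∀ r m → m ≤ r → X (suc r) (suc m) ≡ Y (suc r) (suc m)
  later r m m≤r = ℤₚ.*-cancelˡ-≡ (+ suc m) _ _ (ℤₚ.*-cancelʳ-≡ _ _ (+ c r) {{c≢0 r}}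
    (trans (recX r m m≤r) (trans (cong (+ d r *ᶻ_) (go r m m≤r)) (sym (recY r m m≤r)))))
  go zero    zero    _ = cancel-last (X 0 0) (Y 0 0) (totals 0)
  go (suc r) (suc m) (s≤s m≤r) = later r m m≤r
  go (suc r) zero    _ = cancel-last (X (suc r) 0) (Y (suc r) 0)
    (trans (totals (suc r)) (cong (Y (suc r) 0 +ᶻ_) (sym (∑ᶻ-cong (suc r) λ m m<r → later r m (ℕₚ.≤-pred m<r)))))

-- Solving the recursion on rk points

module Scaling (k : ℕ) where

  private
    K : ℕ
    K = suc k

  -- The order of S(K,r), equal to the row sum of `B K r`.
  scale : ℕ → ℕ
  scale r = r ! * K ℕ.^ r

  scale-suc : ∀ r → + scale (suc r) ≡ + suc r *ᶻ + K *ᶻ + scale r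
  scale-suc r = begin
    + (suc r * r ! * (K * K ℕ.^ r))   ≡⟨ cong +_ (regroup (suc r) (r !) K (K ℕ.^ r)) ⟩
    + (suc r * K * scale r)           ≡⟨ ℤₚ.pos-* (suc r * K) (scale r) ⟩
    + (suc r * K) *ᶻ + scale r        ≡⟨ cong (_*ᶻ + scale r) (ℤₚ.pos-* (suc r) K) ⟩
    + suc r *ᶻ + K *ᶻ + scale r       ∎
    where
    open ≡-Reasoning
    regroup : ∀ s f k p → s * f * (k * p) ≡ s * k * (f * p)
    regroup = solve-∀

  CycleRec : (ℕ → ℕ → ℤ) → Set
  CycleRec X = ∀ r m → m ≤ r → + suc m *ᶻ + K *ᶻ X (suc r) (suc m) *ᶻ + ((r * K) !) ≡ + ((K + r * K) !) *ᶻ X r m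

  fromℕ-CycleRec : (X : ℕ → ℕ → ℕ) →
    (∀ r m → m ≤ r → suc m * K * X (suc r) (suc m) * (r * K) ! ≡ (K + r * K) ! * X r m) → CycleRec (λ r m → + X r m)
  fromℕ-CycleRec X rec r m m≤r = begin
    + suc m *ᶻ + K *ᶻ + x *ᶻ + f   ≡⟨ cong (λ z → z *ᶻ + x *ᶻ + f) (ℤₚ.pos-* (suc m) K) ⟨
    + (suc m * K) *ᶻ + x *ᶻ + f    ≡⟨ cong (_*ᶻ + f) (ℤₚ.pos-* (suc m * K) x) ⟨
    + (suc m * K * x) *ᶻ + f       ≡⟨ ℤₚ.pos-* (suc m * K * x) f ⟨
    + (suc m * K * x * f)          ≡⟨ cong +_ (rec r m m≤r) ⟩
    + ((K + r * K) ! * X r m)      ≡⟨ ℤₚ.pos-* ((K + r * K) !) (X r m) ⟩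
    + ((K + r * K) !) *ᶻ + X r m   ∎
    where
    open ≡-Reasoning
    x f : ℕ
    x = X (suc r) (suc m)
    f = (r * K) !

  -- The factor `suc r * K` gained by `scale` in each row absorbs the `K` of the recursion. The
  -- scaled `X` and the multiple of `Q` by (rK)! then obey one common recursion, and equal row sums
  -- make them agree. It is applied to `cycles` with `B`, and to `excess` with `V`.
  scaled-unique : (X Q : ℕ → ℕ → ℤ) → CycleRec X → (∀ r m → + suc m *ᶻ Q (suc r) (suc m) ≡ + suc r *ᶻ Q r m) →
    (∀ r → + scale r *ᶻ ∑ᶻ (suc r) (X r) ≡ + ((r * K) !) *ᶻ ∑ᶻ (suc r) (Q r)) →
    ∀ r m → m ≤ r → + scale r *ᶻ X r m ≡ + ((r * K) !) *ᶻ Q r m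
  scaled-unique X Q recX absorbQ totals = triangle-unique
    (λ r → (r * K) !) (λ r → suc r * (K + r * K) !) (λ r → ℕₚ._!≢0 (r * K))
    (λ r m → + scale r *ᶻ X r m) (λ r m → + ((r * K) !) *ᶻ Q r m) recX' recQ'
    (λ r → trans (∑ᶻ-*ˡ (suc r) (+ scale r) (X r)) (trans (totals r) (sym (∑ᶻ-*ˡ (suc r) (+ ((r * K) !)) (Q r)))))
    where
    open ≡-Reasoning
    recX' : ∀ r m → m ≤ r → + suc m *ᶻ (+ scale (suc r) *ᶻ X (suc r) (suc m)) *ᶻ + ((r * K) !) ≡
            + (suc r * (K + r * K) !) *ᶻ (+ scale r *ᶻ X r m)
    recX' r m m≤r = begin
      + suc m *ᶻ (+ scale (suc r) *ᶻ x) *ᶻ f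
        ≡⟨ cong (λ z → + suc m *ᶻ (z *ᶻ x) *ᶻ f) (scale-suc r) ⟩
      + suc m *ᶻ (+ suc r *ᶻ + K *ᶻ + scale r *ᶻ x) *ᶻ f
        ≡⟨ regroup (+ suc m) (+ suc r) (+ K) (+ scale r) x f ⟩
      + suc r *ᶻ + scale r *ᶻ (+ suc m *ᶻ + K *ᶻ x *ᶻ f)
        ≡⟨ cong (+ suc r *ᶻ + scale r *ᶻ_) (recX r m m≤r) ⟩
      + suc r *ᶻ + scale r *ᶻ (+ ((K + r * K) !) *ᶻ X r m)
        ≡⟨ swap (+ suc r) (+ scale r) (+ ((K + r * K) !)) (X r m) ⟩
      + suc r *ᶻ + ((K + r * K) !) *ᶻ (+ scale r *ᶻ X r m)
        ≡⟨ cong (_*ᶻ (+ scale r *ᶻ X r m)) (ℤₚ.pos-* (suc r) ((K + r * K) !)) ⟨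
      + (suc r * (K + r * K) !) *ᶻ (+ scale r *ᶻ X r m) ∎
      where
      x f : ℤ
      x = X (suc r) (suc m)
      f = + ((r * K) !)
      regroup : ∀ m r k s x f → m *ᶻ (r *ᶻ k *ᶻ s *ᶻ x) *ᶻ f ≡ r *ᶻ s *ᶻ (m *ᶻ k *ᶻ x *ᶻ f)
      regroup = solveℤ
      swap : ∀ r s g x → r *ᶻ s *ᶻ (g *ᶻ x) ≡ r *ᶻ g *ᶻ (s *ᶻ x)
      swap = solveℤ
    recQ' : ∀ r m → m ≤ r → + suc m *ᶻ (+ ((suc r * K) !) *ᶻ Q (suc r) (suc m)) *ᶻ + ((r * K) !) ≡
            + (suc r * (K + r * K) !) *ᶻ (+ ((r * K) !) *ᶻ Q r m)
    recQ' r m _ = begin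
      + suc m *ᶻ (g *ᶻ Q (suc r) (suc m)) *ᶻ f
        ≡⟨ regroup (+ suc m) g (Q (suc r) (suc m)) f ⟩
      g *ᶻ f *ᶻ (+ suc m *ᶻ Q (suc r) (suc m))
        ≡⟨ cong (g *ᶻ f *ᶻ_) (absorbQ r m) ⟩
      g *ᶻ f *ᶻ (+ suc r *ᶻ Q r m)
        ≡⟨ swap g f (+ suc r) (Q r m) ⟩
      + suc r *ᶻ g *ᶻ (f *ᶻ Q r m)
        ≡⟨ cong (_*ᶻ (f *ᶻ Q r m)) (ℤₚ.pos-* (suc r) ((K + r * K) !)) ⟨
      + (suc r * (K + r * K) !) *ᶻ (f *ᶻ Q r m) ∎
      where
      f g : ℤ
      f = + ((r * K) !)
      g = + ((suc r * K) !)
      regroup : ∀ m g q f → m *ᶻ (g *ᶻ q) *ᶻ f ≡ g *ᶻ f *ᶻ (m *ᶻ q)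
      regroup = solveℤ
      swap : ∀ g f r q → g *ᶻ f *ᶻ (r *ᶻ q) ≡ r *ᶻ g *ᶻ (f *ᶻ q)
      swap = solveℤ

  cycles : ℕ → ℕ → ℕ
  cycles r m = cycleCount K (r * K) m

  cycles-rec : CycleRec (λ r m → + cycles r m)
  cycles-rec = fromℕ-CycleRec cycles λ r m _ → cycleCount-suc k (r * K) m

  cycles-total : ∀ r → ∑ᶻ (suc r) (λ m → + cycles r m) ≡ + ((r * K) !)
  cycles-total r = trans (sym (∑ᶻ-upTo (suc r) (cycles r)))
    (cong +_ (cycleCount-total k (r * K) {suc r} (ℕₚ.m<n+m (r * K) (s≤s z≤n))))

  scaled-cycles : ∀ r m → m ≤ r → + scale r *ᶻ + cycles r m ≡ + ((r * K) !) *ᶻ B K r m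
  scaled-cycles = scaled-unique (λ r m → + cycles r m) (B K) cycles-rec (B-absorb K) λ r →
    trans (cong (+ scale r *ᶻ_) (cycles-total r)) (trans (ℤₚ.*-comm (+ scale r) _) (cong (+ ((r * K) !) *ᶻ_) (sym (B-total K r))))

  -- N times the number of permutations of N - 1 points with m k-cycles, for N = rk.
  shorter : ℕ → ℕ → ℕ
  shorter zero    m = 0
  shorter (suc r) m = (suc r * K) * cycleCount K (k + r * K) m

  -- For r > 0 this is the recursion starting from n = rK - 1 points, multiplied by (n+1)(n+1+K):
  -- the two factors complete the factorials and turn the counts into `shorter`.
  shorter-rec : CycleRec (λ r m → + shorter r m)
  shorter-rec = fromℕ-CycleRec shorter rec
    where
    open ≡-Reasoning
    rec : ∀ r m → m ≤ r → suc m * K * shorter (suc r) (suc m) * (r * K) ! ≡ (K + r * K) ! * shorter r m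
    -- The right side is 0 by the value of `shorter` in row 0; the left side vanishes because K - 1
    -- points cannot hold a cycle of length K.
    rec zero zero _ = trans (cong (λ x → 1 * K * ((1 * K) * x) * 1) none) (vanish K ((K + 0) !))
      where
      none : cycleCount K (k + 0) 1 ≡ 0
      none = count-none (WithCycles? K 1) (Maps (k + 0)) λ {σ} (_ , eq) →
        ℕₚ.<⇒≢ (numKCycles< {R = 1} σ (s≤s (ℕₚ.≤-reflexive refl))) eq
      vanish : ∀ K f → 1 * K * ((1 * K) * 0) * 1 ≡ f * 0
      vanish = solve-∀
    rec (suc r) m _ = begin
      suc m * K * (N * cycleCount K (k + (K + r * K)) (suc m)) * (suc n) !
        ≡⟨ cong (λ x → suc m * K * (N * cycleCount K x (suc m)) * (suc n) !) shift ⟩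
      suc m * K * (N * cycleCount K (K + n) (suc m)) * (suc n * n !)
        ≡⟨ regroup (suc m * K) N (cycleCount K (K + n) (suc m)) (suc n) (n !) ⟩
      N * suc n * (suc m * K * cycleCount K (K + n) (suc m) * n !)
        ≡⟨ cong (N * suc n *_) (cycleCount-suc k n m) ⟩
      N * suc n * ((K + n) ! * cycleCount K n m)
        ≡⟨ cong (λ x → N * suc n * (x ! * cycleCount K n m)) shift ⟨
      N * suc n * ((k + suc n) ! * cycleCount K n m)
        ≡⟨ swap N (suc n) ((k + suc n) !) (cycleCount K n m) ⟩
      N * (k + suc n) ! * (suc n * cycleCount K n m) ∎
      where
      n N : ℕ
      n = k + r * K
      N = suc (k + suc n)
      shift : k + (K + r * K) ≡ K + n
      shift = ℕₚ.+-suc k n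
      regroup : ∀ a N x s f → a * (N * x) * (s * f) ≡ N * s * (a * x * f)
      regroup = solve-∀
      swap : ∀ N s f x → N * s * (f * x) ≡ N * f * (s * x)
      swap = solve-∀

  shorter-total : ∀ r → ∑ᶻ (suc (suc r)) (λ m → + shorter (suc r) m) ≡ + ((suc r * K) !)
  shorter-total r = begin
    ∑ᶻ (suc (suc r)) (λ m → + shorter (suc r) m)
      ≡⟨ ∑ᶻ-upTo (suc (suc r)) (shorter (suc r)) ⟨
    + ∑ (upTo (suc (suc r))) (shorter (suc r))
      ≡⟨ cong +_ (∑-*ˡ (upTo (suc (suc r))) (suc r * K) (cycleCount K (k + r * K))) ⟩
    + ((suc r * K) * ∑ (upTo (suc (suc r))) (cycleCount K (k + r * K)))
      ≡⟨ cong (λ x → + ((suc r * K) * x)) (cycleCount-total k (k + r * K) {suc (suc r)} (s≤s (ℕₚ.+-monoʳ-≤ k (ℕₚ.m≤n+m (r * K) K)))) ⟩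
    + ((suc r * K) !) ∎
    where open ≡-Reasoning

  excess : ℕ → ℕ → ℤ
  excess r m = + cycles r m -ᶻ + shorter r m

  -- The recursion is linear, so the difference inherits it. Its row sums, 1 in row 0 and N! - N
  -- (N-1)! = 0 afterwards, are those of `V`.
  scaled-excess : ∀ r m → m ≤ r → + scale r *ᶻ excess r m ≡ + ((r * K) !) *ᶻ V r m
  scaled-excess = scaled-unique excess V rec V-absorb totals
    where
    open ≡-Reasoning
    rec : CycleRec excess
    rec r m m≤r = begin
      + suc m *ᶻ + K *ᶻ (x -ᶻ y) *ᶻ f
        ≡⟨ distribute (+ suc m *ᶻ + K) x y f ⟩
      + suc m *ᶻ + K *ᶻ x *ᶻ f -ᶻ + suc m *ᶻ + K *ᶻ y *ᶻ f
        ≡⟨ cong₂ _-ᶻ_ (cycles-rec r m m≤r) (shorter-rec r m m≤r) ⟩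
      g *ᶻ + cycles r m -ᶻ g *ᶻ + shorter r m
        ≡⟨ factor g (+ cycles r m) (+ shorter r m) ⟩
      g *ᶻ excess r m ∎
      where
      x y f g : ℤ
      x = + cycles (suc r) (suc m)
      y = + shorter (suc r) (suc m)
      f = + ((r * K) !)
      g = + ((K + r * K) !)
      distribute : ∀ a x y f → a *ᶻ (x -ᶻ y) *ᶻ f ≡ a *ᶻ x *ᶻ f -ᶻ a *ᶻ y *ᶻ f
      distribute = solveℤ
      factor : ∀ g x y → g *ᶻ x -ᶻ g *ᶻ y ≡ g *ᶻ (x -ᶻ y)
      factor = solveℤ
    split : ∀ n r → ∑ᶻ n (excess r) ≡ ∑ᶻ n (λ m → + cycles r m) -ᶻ ∑ᶻ n (λ m → + shorter r m)
    split n r = begin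
      ∑ᶻ n (excess r)
        ≡⟨ ∑ᶻ-cong n (λ m _ → signs (+ cycles r m) (+ shorter r m)) ⟩
      ∑ᶻ n (λ m → 1ℤ *ᶻ + cycles r m +ᶻ -1ℤ *ᶻ + shorter r m)
        ≡⟨ ∑ᶻ-linear n 1ℤ -1ℤ (λ m → + cycles r m) (λ m → + shorter r m) ⟩
      1ℤ *ᶻ ∑ᶻ n (λ m → + cycles r m) +ᶻ -1ℤ *ᶻ ∑ᶻ n (λ m → + shorter r m)
        ≡⟨ signs (∑ᶻ n (λ m → + cycles r m)) (∑ᶻ n (λ m → + shorter r m)) ⟨
      ∑ᶻ n (λ m → + cycles r m) -ᶻ ∑ᶻ n (λ m → + shorter r m) ∎
      where
      signs : ∀ x y → x -ᶻ y ≡ 1ℤ *ᶻ x +ᶻ -1ℤ *ᶻ y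
      signs = solveℤ
    totals : ∀ r → + scale r *ᶻ ∑ᶻ (suc r) (excess r) ≡ + ((r * K) !) *ᶻ ∑ᶻ (suc r) (V r)
    totals zero    = cong (1ℤ *ᶻ_) (trans (split 1 0) (cong (_-ᶻ 0ℤ) (cycles-total 0)))
    totals (suc r) = trans (cong (+ scale (suc r) *ᶻ_) zero-sum) (trans (ℤₚ.*-zeroʳ (+ scale (suc r)))
      (sym (trans (cong (+ ((suc r * K) !) *ᶻ_) (V-total r)) (ℤₚ.*-zeroʳ (+ ((suc r * K) !))))))
      where
      zero-sum : ∑ᶻ (suc (suc r)) (excess (suc r)) ≡ 0ℤ
      zero-sum = trans (split (suc (suc r)) (suc r)) (trans (cong₂ _-ᶻ_ (cycles-total (suc r)) (shorter-total r))
        (ℤₚ.+-inverseʳ (+ ((suc r * K) !))))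

-- The derangement numbers D(k,N)

-- The homogeneous evaluation Σ_{f ≤ r} g(f) a^f b^(r-f), by Horner's scheme.
horner : (a b : ℕ) → ℕ → (ℕ → ℤ) → ℤ
horner a b zero    g = g 0
horner a b (suc r) g = + (b ℕ.^ suc r) *ᶻ g 0 +ᶻ + a *ᶻ horner a b r (g ∘ suc)

module _ (a b : ℕ) where

  horner-∑ᶻ : ∀ r g → horner a b r g ≡ ∑ᶻ (suc r) (λ f → g f *ᶻ + (a ℕ.^ f * b ℕ.^ (r ∸ f)))
  horner-∑ᶻ zero    g = sym (trans (ℤₚ.+-identityʳ _) (ℤₚ.*-identityʳ (g 0)))
  horner-∑ᶻ (suc r) g = cong₂ _+ᶻ_
    (trans (ℤₚ.*-comm (+ (b ℕ.^ suc r)) (g 0)) (cong (λ x → g 0 *ᶻ + x) (sym (ℕₚ.+-identityʳ (b ℕ.^ suc r)))))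
    (trans (cong (+ a *ᶻ_) (horner-∑ᶻ r (g ∘ suc)))
      (trans (sym (∑ᶻ-*ˡ (suc r) (+ a) (λ f → g (suc f) *ᶻ + (a ℕ.^ f * b ℕ.^ (r ∸ f)))))
        (∑ᶻ-cong (suc r) λ f _ → absorb f)))
    where
    rotate : ∀ a g w → a *ᶻ (g *ᶻ w) ≡ g *ᶻ (a *ᶻ w)
    rotate = solveℤ
    absorb : ∀ f → + a *ᶻ (g (suc f) *ᶻ + (a ℕ.^ f * b ℕ.^ (r ∸ f))) ≡ g (suc f) *ᶻ + (a ℕ.^ suc f * b ℕ.^ (r ∸ f))
    absorb f = trans (rotate (+ a) (g (suc f)) (+ (a ℕ.^ f * b ℕ.^ (r ∸ f))))
      (cong (g (suc f) *ᶻ_) (trans (sym (ℤₚ.pos-* a (a ℕ.^ f * b ℕ.^ (r ∸ f)))) (cong +_ (sym (ℕₚ.*-assoc a (a ℕ.^ f) _)))))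

  horner-linear : ∀ r x y g h → horner a b r (λ f → x *ᶻ g f +ᶻ y *ᶻ h f) ≡ x *ᶻ horner a b r g +ᶻ y *ᶻ horner a b r h
  horner-linear zero    x y g h = refl
  horner-linear (suc r) x y g h = trans
    (cong (λ z → + (b ℕ.^ suc r) *ᶻ (x *ᶻ g 0 +ᶻ y *ᶻ h 0) +ᶻ + a *ᶻ z) (horner-linear r x y (g ∘ suc) (h ∘ suc)))
    (lemma (+ (b ℕ.^ suc r)) (+ a) x y (g 0) (h 0) (horner a b r (g ∘ suc)) (horner a b r (h ∘ suc)))
    where
    lemma : ∀ B a x y u v s t → B *ᶻ (x *ᶻ u +ᶻ y *ᶻ v) +ᶻ a *ᶻ (x *ᶻ s +ᶻ y *ᶻ t) ≡
            x *ᶻ (B *ᶻ u +ᶻ a *ᶻ s) +ᶻ y *ᶻ (B *ᶻ v +ᶻ a *ᶻ t)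
    lemma = solveℤ

  horner-cong : ∀ r {g h : ℕ → ℤ} → (∀ f → f ≤ r → g f ≡ h f) → horner a b r g ≡ horner a b r h
  horner-cong zero    eq = eq 0 z≤n
  horner-cong (suc r) eq = cong₂ (λ x y → + (b ℕ.^ suc r) *ᶻ x +ᶻ + a *ᶻ y) (eq 0 z≤n) (horner-cong r λ f f≤r → eq (suc f) (s≤s f≤r))

  -- Without its top coefficient, the form of degree r + 1 is divisible by b.
  horner-vanishing-last : ∀ r g → g (suc r) ≡ 0ℤ → horner a b (suc r) g ≡ + b *ᶻ horner a b r g
  horner-vanishing-last zero    g last = trans (cong (λ x → + (b * 1) *ᶻ g 0 +ᶻ + a *ᶻ x) last)
    (trans (cong (+ (b * 1) *ᶻ g 0 +ᶻ_) (ℤₚ.*-zeroʳ (+ a)))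
      (trans (ℤₚ.+-identityʳ _) (cong (λ x → + x *ᶻ g 0) (ℕₚ.*-identityʳ b))))
  horner-vanishing-last (suc r) g last = trans
    (cong₂ (λ x y → x *ᶻ g 0 +ᶻ + a *ᶻ y) (ℤₚ.pos-* b (b ℕ.^ suc r)) (horner-vanishing-last r (g ∘ suc) last))
    (lemma (+ b) (+ (b ℕ.^ suc r)) (g 0) (+ a) (horner a b r (g ∘ suc)))
    where
    lemma : ∀ b p g a s → b *ᶻ p *ᶻ g +ᶻ a *ᶻ (b *ᶻ s) ≡ b *ᶻ (p *ᶻ g +ᶻ a *ᶻ s)
    lemma = solveℤ

  -- One step of the binomial theorem for (a - b)^(r+1), by the Pascal rule. At a = k and b = k + 1
  -- the factor is -1.
  horner-V : ∀ r → horner a b (suc r) (V (suc r)) ≡ (+ a -ᶻ + b) *ᶻ horner a b r (V r)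
  horner-V r = begin
    P *ᶻ - V r 0 +ᶻ + a *ᶻ horner a b r (λ f → V r f -ᶻ V r (suc f))
      ≡⟨ cong (λ z → P *ᶻ - V r 0 +ᶻ + a *ᶻ z) (trans (horner-cong r λ f _ → unit (V r f) (V r (suc f))) (horner-linear r 1ℤ -1ℤ (V r) (V r ∘ suc))) ⟩
    P *ᶻ - V r 0 +ᶻ + a *ᶻ (1ℤ *ᶻ horner a b r (V r) +ᶻ -1ℤ *ᶻ horner a b r (V r ∘ suc))
      ≡⟨ regroup P (V r 0) (+ a) (horner a b r (V r)) (horner a b r (V r ∘ suc)) ⟩
    + a *ᶻ horner a b r (V r) -ᶻ horner a b (suc r) (V r)
      ≡⟨ cong (+ a *ᶻ horner a b r (V r) -ᶻ_) (horner-vanishing-last r (V r) (V-beyond (ℕₚ.n<1+n r))) ⟩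
    + a *ᶻ horner a b r (V r) -ᶻ + b *ᶻ horner a b r (V r)
      ≡⟨ factor (+ a) (+ b) (horner a b r (V r)) ⟩
    (+ a -ᶻ + b) *ᶻ horner a b r (V r) ∎
    where
    open ≡-Reasoning
    P : ℤ
    P = + (b ℕ.^ suc r)
    unit : ∀ v w → v -ᶻ w ≡ 1ℤ *ᶻ v +ᶻ -1ℤ *ᶻ w
    unit = solveℤ
    regroup : ∀ p v a s t → p *ᶻ - v +ᶻ a *ᶻ (1ℤ *ᶻ s +ᶻ -1ℤ *ᶻ t) ≡ a *ᶻ s -ᶻ (p *ᶻ v +ᶻ a *ᶻ t)
    regroup = solveℤ
    factor : ∀ a b s → a *ᶻ s -ᶻ b *ᶻ s ≡ (a -ᶻ b) *ᶻ s
    factor = solveℤ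

module _ (k : ℕ) where

  private
    K : ℕ
    K = suc k

  horner-V-unit : ∀ r → horner k K r (V r) ≡ V r 0
  horner-V-unit zero    = refl
  horner-V-unit (suc r) = trans (horner-V k K r) (trans (cong₂ _*ᶻ_ (minus-one (+ k)) (horner-V-unit r)) (ℤₚ.-1*i≡-i (V r 0)))
    where
    minus-one : ∀ x → x -ᶻ (1ℤ +ᶻ x) ≡ -1ℤ
    minus-one = solveℤ

  -- Evaluation at (k, K) is linear and turns the recursion of `B 1` into that of `B K` at m = 0:
  -- the first term lacks a top coefficient and so yields the factor K, and the signed binomials
  -- yield (-1)^(r+1).
  horner-B₁ : ∀ r → horner k K r (B 1 r) ≡ B K r 0
  horner-B₁ zero    = refl
  horner-B₁ (suc r) = begin
    horner k K (suc r) (λ f → 1ℤ *ᶻ + suc r *ᶻ B 1 r f +ᶻ V (suc r) f)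
      ≡⟨ horner-cong k K (suc r) (λ f _ → cong (1ℤ *ᶻ + suc r *ᶻ B 1 r f +ᶻ_) (sym (ℤₚ.*-identityˡ (V (suc r) f)))) ⟩
    horner k K (suc r) (λ f → 1ℤ *ᶻ + suc r *ᶻ B 1 r f +ᶻ 1ℤ *ᶻ V (suc r) f)
      ≡⟨ horner-linear k K (suc r) (1ℤ *ᶻ + suc r) 1ℤ (B 1 r) (V (suc r)) ⟩
    1ℤ *ᶻ + suc r *ᶻ horner k K (suc r) (B 1 r) +ᶻ 1ℤ *ᶻ horner k K (suc r) (V (suc r))
      ≡⟨ cong₂ (λ x y → 1ℤ *ᶻ + suc r *ᶻ x +ᶻ 1ℤ *ᶻ y)
           (trans (horner-vanishing-last k K r (B 1 r) (B-beyond 1 (ℕₚ.n<1+n r))) (cong (+ K *ᶻ_) (horner-B₁ r))) (horner-V-unit (suc r)) ⟩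
    1ℤ *ᶻ + suc r *ᶻ (+ K *ᶻ B K r 0) +ᶻ 1ℤ *ᶻ V (suc r) 0
      ≡⟨ regroup (+ suc r) (+ K) (B K r 0) (V (suc r) 0) ⟩
    + K *ᶻ + suc r *ᶻ B K r 0 +ᶻ V (suc r) 0 ∎
    where
    open ≡-Reasoning
    regroup : ∀ r k b v → 1ℤ *ᶻ r *ᶻ (k *ᶻ b) +ᶻ 1ℤ *ᶻ v ≡ k *ᶻ r *ᶻ b +ᶻ v
    regroup = solveℤ

-- For cycles of length 1, that is fixed points, both scaling factors are r! and cancel.
cycleCount₁ : ∀ r f → f ≤ r → + cycleCount 1 r f ≡ B 1 r f
cycleCount₁ r f f≤r = ℤₚ.*-cancelˡ-≡ (+ (r !)) _ _ {{ℕₚ._!≢0 r}}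
  (subst₂ (λ s N → + s *ᶻ + cycleCount 1 N f ≡ + (N !) *ᶻ B 1 r f)
    (trans (cong (r ! *_) (ℕₚ.^-zeroˡ r)) (ℕₚ.*-identityʳ (r !))) (ℕₚ.*-identityʳ r) (Scaling.scaled-cycles 0 r f f≤r))

-- Labellings of a fixed permutation

count-map : ∀ {A C : Set} {P : C → Set} (P? : Decidable P) (g : A → C) xs → count P? (map g xs) ≡ count (P? ∘ g) xs
count-map P? g []       = refl
count-map P? g (x ∷ xs) with does (P? (g x))
... | true  = cong suc (count-map P? g xs)
... | false = count-map P? g xs

count-concatMap : ∀ {A C : Set} {P : C → Set} (P? : Decidable P) (g : A → List C) xs →
                  count P? (concatMap g xs) ≡ ∑ xs (λ x → count P? (g x))
count-concatMap P? g []       = refl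
count-concatMap P? g (x ∷ xs) = trans (cong length (Listₚ.filter-++ P? (g x) (concatMap g xs)))
  (trans (Listₚ.length-++ (filter P? (g x))) (cong (_+_ (count P? (g x))) (count-concatMap P? g xs)))

-- The conditions on the coordinates are independent. For derangements this holds once the
-- permutation is fixed, each coordinate restricting its own label.
count-allVecs : ∀ {A : Set} N (xs : List A) (w : Fin N → A → Bool) →
  count (λ x → T? (allB λ i → w i (lookup x i))) (allVecs N xs) ≡
  product (List.tabulate λ i → count (λ a → T? (w i a)) xs)
count-allVecs zero    xs w = refl
count-allVecs {A} (suc N) xs w = begin
  count (λ x → T? (allB λ i → w i (lookup x i))) (allVecs (suc N) xs)
    ≡⟨ count-concatMap _ (λ a → map (a ∷_) (allVecs N xs)) xs ⟩
  ∑ xs (λ a → count (λ x → T? (allB λ i → w i (lookup x i))) (map (a ∷_) (allVecs N xs)))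
    ≡⟨ ∑-cong xs (λ a → trans (count-map _ (a ∷_) (allVecs N xs)) (first a)) ⟩
  ∑ xs (λ a → 𝟙 (w zero a) * rest)
    ≡⟨ ∑-*ʳ xs rest (λ a → 𝟙 (w zero a)) ⟩
  ∑ xs (λ a → 𝟙 (w zero a)) * rest
    ≡⟨ cong₂ _*_ (sym (count-∑ (λ a → T? (w zero a)) xs)) (count-allVecs N xs (w ∘ suc)) ⟩
  product (List.tabulate λ i → count (λ a → T? (w i a)) xs) ∎
  where
  open ≡-Reasoning
  rest : ℕ
  rest = count (λ v → T? (allB λ i → w (suc i) (lookup v i))) (allVecs N xs)
  unfold : ∀ a v → allB (λ i → w i (lookup (a ∷ v) i)) ≡ w zero a ∧ allB (λ i → w (suc i) (lookup v i))
  unfold a v = cong (λ bs → w zero a ∧ Data.Bool.ListAction.and bs)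
    (trans (Listₚ.map-tabulate suc (λ i → w i (lookup (a ∷ v) i))) (sym (Listₚ.map-tabulate id (λ i → w (suc i) (lookup v i)))))
  guard : ∀ b → count (λ v → T? (b ∧ allB λ i → w (suc i) (lookup v i))) (allVecs N xs) ≡ 𝟙 b * rest
  guard true  = sym (ℕₚ.+-identityʳ rest)
  guard false = count-none _ (allVecs N xs) λ ()
  first : ∀ a → count (λ v → T? (allB λ i → w i (lookup (a ∷ v) i))) (allVecs N xs) ≡ 𝟙 (w zero a) * rest
  first a = trans (count-cong _ _ (allVecs N xs) (λ {v} → subst T (unfold a v)) (λ {v} → subst T (sym (unfold a v)))) (guard (w zero a))

product-two-valued : ∀ n a b (p : Fin n → Bool) →
  product (List.tabulate λ i → if p i then a else b) ≡
  a ℕ.^ sum (List.tabulate (𝟙 ∘ p)) * b ℕ.^ (n ∸ sum (List.tabulate (𝟙 ∘ p)))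
product-two-valued zero    a b p = refl
product-two-valued (suc n) a b p with p zero
... | true  = trans (cong (a *_) (product-two-valued n a b (p ∘ suc))) (sym (ℕₚ.*-assoc a _ _))
... | false = begin
  b * product (List.tabulate λ i → if p (suc i) then a else b)  ≡⟨ cong (b *_) (product-two-valued n a b (p ∘ suc)) ⟩
  b * (a ℕ.^ c * b ℕ.^ (n ∸ c))                                 ≡⟨ rotate b (a ℕ.^ c) (b ℕ.^ (n ∸ c)) ⟩
  a ℕ.^ c * b ℕ.^ suc (n ∸ c)                                   ≡⟨ cong (λ e → a ℕ.^ c * b ℕ.^ e) (ℕₚ.+-∸-assoc 1 (c≤n n (p ∘ suc))) ⟨
  a ℕ.^ c * b ℕ.^ (suc n ∸ c)                                   ∎
  where
  open ≡-Reasoning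
  c : ℕ
  c = sum (List.tabulate (𝟙 ∘ p ∘ suc))
  rotate : ∀ b x y → b * (x * y) ≡ x * (b * y)
  rotate = solve-∀
  c≤n : ∀ n (q : Fin n → Bool) → sum (List.tabulate (𝟙 ∘ q)) ≤ n
  c≤n zero    q = z≤n
  c≤n (suc n) q with q zero
  ... | true  = s≤s (c≤n n (q ∘ suc))
  ... | false = ℕₚ.m≤n⇒m≤1+n (c≤n n (q ∘ suc))

module _ (k : ℕ) where

  private
    K : ℕ
    K = suc k

  weight : ℕ → ℕ → ℕ
  weight N f = k ℕ.^ f * K ℕ.^ (N ∸ f)

  count-labels : ∀ {N} (σ : Vec (Fin N) N) →
    count (λ x → T? (isDerangement (x , σ))) (allVecs N (allFin K)) ≡ weight N (numKCycles 1 σ)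
  count-labels {N} σ = begin
    count (λ x → T? (isDerangement (x , σ))) (allVecs N (allFin K))
      ≡⟨ count-allVecs N (allFin K) (λ i a → not (lookup σ i == i) ∨ not (toℕ a ℕ.≡ᵇ 0)) ⟩
    product (List.tabulate λ i → count (λ (a : Fin K) → T? (not (lookup σ i == i) ∨ not (toℕ a ℕ.≡ᵇ 0))) (allFin K))
      ≡⟨ cong product (Listₚ.tabulate-cong λ i → labels (lookup σ i == i)) ⟩
    product (List.tabulate λ i → if lookup σ i == i then k else K)
      ≡⟨ product-two-valued N k K (λ i → lookup σ i == i) ⟩
    weight N (sum (List.tabulate λ i → 𝟙 (lookup σ i == i)))
      ≡⟨ cong (weight N) fixed ⟩
    weight N (numKCycles 1 σ) ∎
    where
    open ≡-Reasoning
    labels : ∀ b → count (λ (a : Fin K) → T? (not b ∨ not (toℕ a ℕ.≡ᵇ 0))) (allFin K) ≡ (if b then k else K)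
    labels false = trans (cong length (Listₚ.filter-all (λ _ → T? true) {xs = allFin K} (All.tabulate λ _ → tt)))
      (Listₚ.length-tabulate {n = K} id)
    -- The label 0 drops out of the filter by computation, leaving the k labels of the form `suc`.
    labels true  = trans (cong length (Listₚ.filter-all (λ (a : Fin K) → T? (not (toℕ a ℕ.≡ᵇ 0))) {xs = List.tabulate suc} (Allₚ.tabulate⁺ λ _ → tt)))
      (Listₚ.length-tabulate {n = k} suc)
    fixed : sum (List.tabulate λ i → 𝟙 (lookup σ i == i)) ≡ numKCycles 1 σ
    fixed = begin
      sum (List.tabulate λ i → 𝟙 (lookup σ i == i))
        ≡⟨ ∑-allFin (λ i → 𝟙 (lookup σ i == i)) ⟨
      ∑ (allFin N) (λ i → 𝟙 (lookup σ i == i))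
        -- At length 1 the minimality test runs over an empty list, so only a conjunct `true` has to
        -- be removed.
        ≡⟨ ∑-cong (allFin N) (λ i → cong 𝟙 (∧-identityʳ (lookup σ i == i))) ⟨
      ∑ (allFin N) (λ i → 𝟙 (inKCycle 1 σ i))
        ≡⟨ count-∑ (T? ∘ inKCycle 1 σ) (allFin N) ⟨
      kCyclePoints 1 σ
        ≡⟨ trans (cong (_/ 1) (sym (ℕₚ.*-identityʳ (kCyclePoints 1 σ)))) (m*n/n≡m (kCyclePoints 1 σ) 1) ⟨
      numKCycles 1 σ ∎

  D-fixed-points : ∀ N → D K N ≡ ∑ (upTo (suc N)) (λ f → cycleCount 1 N f * weight N f)
  D-fixed-points N = begin
    D K N
      ≡⟨ count-concatMap (T? ∘ isDerangement) (λ x → map (x ,_) (Perms N)) labellings ⟩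
    ∑ labellings (λ x → count (T? ∘ isDerangement) (map (x ,_) (Perms N)))
      ≡⟨ ∑-cong labellings (λ x → trans (count-map (T? ∘ isDerangement) (x ,_) (Perms N)) (count-∑ _ (Perms N))) ⟩
    ∑ labellings (λ x → ∑ (Perms N) (λ σ → 𝟙 (isDerangement (x , σ))))
      ≡⟨ ∑-swap labellings (Perms N) _ ⟩
    ∑ (Perms N) (λ σ → ∑ labellings (λ x → 𝟙 (isDerangement (x , σ))))
      ≡⟨ ∑-cong (Perms N) (λ σ → trans (sym (count-∑ (λ x → T? (isDerangement (x , σ))) labellings)) (count-labels σ)) ⟩
    ∑ (Perms N) (λ σ → weight N (numKCycles 1 σ))
      ≡⟨ cong (λ σs → ∑ σs (λ σ → weight N (numKCycles 1 σ))) (Listₚ.filter-≐ (T? ∘ isPerm) Perm? (isPerm⇒Perm , Perm⇒isPerm) (Maps N)) ⟩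
    ∑ (filter Perm? (Maps N)) (λ σ → weight N (numKCycles 1 σ))
      ≡⟨ ∑-fibres Perm? ℕ._≟_ (numKCycles 1) (Maps N) (upTo⁺ (suc N))
           (λ {σ} _ → ∈-upTo⁺ (numKCycles< σ (s≤s (ℕₚ.≤-reflexive (sym (ℕₚ.*-identityʳ N)))))) (weight N) ⟩
    ∑ (upTo (suc N)) (λ f → cycleCount 1 N f * weight N f) ∎
    where
    open ≡-Reasoning
    labellings : List (Vec (Fin K) N)
    labellings = allVecs N (allFin K)

  D≡B : ∀ N → + D K N ≡ B K N 0
  D≡B N = begin
    + D K N
      ≡⟨ cong +_ (D-fixed-points N) ⟩
    + ∑ (upTo (suc N)) (λ f → cycleCount 1 N f * weight N f)
      ≡⟨ ∑ᶻ-upTo (suc N) _ ⟩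
    ∑ᶻ (suc N) (λ f → + (cycleCount 1 N f * weight N f))
      ≡⟨ ∑ᶻ-cong (suc N) (λ f f<sN → trans (ℤₚ.pos-* (cycleCount 1 N f) (weight N f)) (cong (_*ᶻ + weight N f) (cycleCount₁ N f (ℕₚ.≤-pred f<sN)))) ⟩
    ∑ᶻ (suc N) (λ f → B 1 N f *ᶻ + weight N f)
      ≡⟨ horner-∑ᶻ k K N (B 1 N) ⟨
    horner k K N (B 1 N)
      ≡⟨ horner-B₁ k N ⟩
    B K N 0 ∎
    where open ≡-Reasoning

  -- If D(K,N+1) = K (N+1) D(K,N) ± 1 were 0, the product K (N+1) D(K,N) would be 1, forcing K = 1.
  -- For K = 1 the claim fails already at D(1,1) = 0.
  D-nonzero : 0 < k → ∀ N → D K N ≢ 0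
  D-nonzero 0<k zero    ()
  D-nonzero 0<k (suc N) D≡0 = ℕₚ.<⇒≢ (s≤s 0<k) (sym (ℕₚ.m*n≡1⇒m≡1 K (suc N) (ℕₚ.m*n≡1⇒m≡1 (K * suc N) (D K N) unit)))
    where
    open ≡-Reasoning
    opposite : + (K * suc N * D K N) ≡ - V (suc N) 0
    opposite = cancel (begin
      + (K * suc N * D K N) +ᶻ V (suc N) 0
        ≡⟨ cong (_+ᶻ V (suc N) 0) (trans (ℤₚ.pos-* (K * suc N) (D K N)) (cong₂ _*ᶻ_ (ℤₚ.pos-* K (suc N)) (D≡B N))) ⟩
      B K (suc N) 0
        ≡⟨ D≡B (suc N) ⟨
      + D K (suc N)
        ≡⟨ cong +_ D≡0 ⟩
      0ℤ ∎)
      where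
      strip : ∀ x y → x ≡ x +ᶻ y +ᶻ - y
      strip = solveℤ
      cancel : ∀ {x y} → x +ᶻ y ≡ 0ℤ → x ≡ - y
      cancel {x} {y} eq = trans (strip x y) (trans (cong (_+ᶻ - y) eq) (ℤₚ.+-identityˡ (- y)))
    unit : K * suc N * D K N ≡ 1
    unit = trans (cong ∣_∣ opposite) (trans (ℤₚ.∣-i∣≡∣i∣ (V (suc N) 0)) (V-first-unit (suc N)))

-- The conditional expectation

divℚ-+ : ∀ x y z {a b c} → a ≢ 0 → b ≢ 0 → c ≢ 0 →
         x *ᶻ + (b * c) ≡ (y *ᶻ + c +ᶻ z *ᶻ + b) *ᶻ + a → divℚ x a ≡ divℚ y b +ℚ divℚ z c
divℚ-+ x y z {zero}  a≢0 b≢0 c≢0 eq = contradiction refl a≢0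
divℚ-+ x y z {suc a} {zero} a≢0 b≢0 c≢0 eq = contradiction refl b≢0
divℚ-+ x y z {suc a} {suc b} {zero} a≢0 b≢0 c≢0 eq = contradiction refl c≢0
-- Normalised fractions are reduced to lowest terms, which hides the cross product; among
-- unnormalised ones equality is precisely the equation `eq`.
divℚ-+ x y z {suc a} {suc b} {suc c} _ _ _ eq = ℚₚ.toℚᵘ-injective (begin
  ℚ.toℚᵘ (x ℚ./ suc a)                                ≈⟨ ℚₚ.toℚᵘ-fromℚᵘ (mkℚᵘ x a) ⟩
  mkℚᵘ x a                                            ≈⟨ *≡* eq ⟩
  mkℚᵘ y b ℚᵘ.+ mkℚᵘ z c                              ≈⟨ ℚᵘₚ.+-cong (ℚₚ.toℚᵘ-fromℚᵘ (mkℚᵘ y b)) (ℚₚ.toℚᵘ-fromℚᵘ (mkℚᵘ z c)) ⟨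
  ℚ.toℚᵘ (y ℚ./ suc b) ℚᵘ.+ ℚ.toℚᵘ (z ℚ./ suc c)      ≈⟨ ℚₚ.toℚᵘ-homo-+ (y ℚ./ suc b) (z ℚ./ suc c) ⟨
  ℚ.toℚᵘ (y ℚ./ suc b ℚ.+ z ℚ./ suc c)                ∎)
  where open ℚᵘₚ.≃-Reasoning

module _ (k r m : ℕ) (m≤n : m ≤ suc r) where

  private
    K n N s A total : ℕ
    K = suc (suc k)
    n = suc r
    -- In this order of factors `N` reduces to `2 + (k + r * K)`, the shape required for the sum of
    -- the values π(1); the stated order is restored at the very end.
    N = n * K
    s = n ∸ m
    A = cycleCount K N m
    total = ∑ (PermsWithKCycles K N m) valAt1
    open Scaling (suc k)

    m+s≡n : m + s ≡ n
    m+s≡n = ℕₚ.m+[n∸m]≡n m≤n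

    D≢0 : D K s ≢ 0
    D≢0 = D-nonzero (suc k) (s≤s z≤n) s

  length-PermsWithKCycles : length (PermsWithKCycles K N m) ≡ A
  length-PermsWithKCycles = cong length (PermsWithKCycles≡filter K N m)

  -- No permutation is exhibited: if A were 0, the closed formula would force `B K n m` to vanish,
  -- whereas absorption carries nonvanishing up from D(K,s).
  cycleCount-nonzero : A ≢ 0
  cycleCount-nonzero A≡0 = subst (λ t → B K t m ≢ 0ℤ) m+s≡n
    (B-nonzero K m s λ B≡0 → D≢0 (ℤₚ.+-injective (trans (D≡B (suc k) s) B≡0)))
    (ℤₚ.*-cancelˡ-≡ (+ (N !)) _ _ {{ℕₚ._!≢0 N}} (begin
      + (N !) *ᶻ B K n m   ≡⟨ scaled-cycles n m m≤n ⟨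
      + scale n *ᶻ + A     ≡⟨ cong (λ x → + scale n *ᶻ + x) A≡0 ⟩
      + scale n *ᶻ 0ℤ      ≡⟨ ℤₚ.*-zeroʳ (+ scale n) ⟩
      0ℤ                   ≡⟨ ℤₚ.*-zeroʳ (+ (N !)) ⟨
      + (N !) *ᶻ 0ℤ        ∎))
    where open ≡-Reasoning

  -- The closed formulas for U and A share the factor N! / `scale n`, and the binomial coefficient
  -- common to `V n m` and `B K n m` cancels as well.
  excess-ratio : excess n m *ᶻ + D K s ≡ (- (+ 1)) ^ s *ᶻ + A
  excess-ratio = ℤₚ.*-cancelˡ-≡ (+ scale n) _ _ {{ℕₚ.m*n≢0 (n !) (K ℕ.^ n) {{ℕₚ._!≢0 n}} {{ℕₚ.m^n≢0 K n}}}} (begin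
    + scale n *ᶻ (excess n m *ᶻ + D K s)   ≡⟨ ℤₚ.*-assoc (+ scale n) (excess n m) (+ D K s) ⟨
    + scale n *ᶻ excess n m *ᶻ + D K s     ≡⟨ cong (_*ᶻ + D K s) (scaled-excess n m m≤n) ⟩
    + (N !) *ᶻ V n m *ᶻ + D K s            ≡⟨ ℤₚ.*-assoc (+ (N !)) (V n m) (+ D K s) ⟩
    + (N !) *ᶻ (V n m *ᶻ + D K s)          ≡⟨ cong (+ (N !) *ᶻ_) ratio ⟩
    + (N !) *ᶻ (ε *ᶻ B K n m)              ≡⟨ rotate (+ (N !)) ε (B K n m) ⟩
    ε *ᶻ (+ (N !) *ᶻ B K n m)              ≡⟨ cong (ε *ᶻ_) (scaled-cycles n m m≤n) ⟨
    ε *ᶻ (+ scale n *ᶻ + A)                ≡⟨ rotate ε (+ scale n) (+ A) ⟩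
    + scale n *ᶻ (ε *ᶻ + A)                ∎)
    where
    open ≡-Reasoning
    ε : ℤ
    ε = (- (+ 1)) ^ s
    rotate : ∀ x y z → x *ᶻ (y *ᶻ z) ≡ y *ᶻ (x *ᶻ z)
    rotate = solveℤ
    ratio : V n m *ᶻ + D K s ≡ ε *ᶻ B K n m
    ratio = trans (cong (V n m *ᶻ_) (D≡B (suc k) s))
      (subst₂ (λ t e → V t m *ᶻ B K s 0 ≡ e *ᶻ B K t m) m+s≡n (V-first s) (V-B-ratio K m s))

  twice-total : + 2 *ᶻ + total ≡ + (N + 1) *ᶻ + A +ᶻ excess n m
  twice-total = begin
    + 2 *ᶻ + total
      ≡⟨ insert (+ 2 *ᶻ + total) (+ shorter n m) ⟩
    + 2 *ᶻ + total +ᶻ + shorter n m -ᶻ + shorter n m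
      ≡⟨ cong (λ x → x +ᶻ + shorter n m -ᶻ + shorter n m) (ℤₚ.pos-* 2 total) ⟨
    + (2 * total + shorter n m) -ᶻ + shorter n m
      ≡⟨ cong (λ x → + x -ᶻ + shorter n m) (∑-valAt1 (k + r * K) m (s≤s (s≤s z≤n))) ⟩
    + ((2 + N) * A) -ᶻ + shorter n m
      ≡⟨ cong (λ x → + x -ᶻ + shorter n m) (unfold N A) ⟩
    + ((N + 1) * A + A) -ᶻ + shorter n m
      ≡⟨ cong (λ x → x +ᶻ + A -ᶻ + shorter n m) (ℤₚ.pos-* (N + 1) A) ⟩
    + (N + 1) *ᶻ + A +ᶻ + A -ᶻ + shorter n m
      ≡⟨ ℤₚ.+-assoc (+ (N + 1) *ᶻ + A) (+ A) (- + shorter n m) ⟩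
    + (N + 1) *ᶻ + A +ᶻ excess n m ∎
    where
    open ≡-Reasoning
    insert : ∀ x y → x ≡ x +ᶻ y -ᶻ y
    insert = solveℤ
    unfold : ∀ N A → (2 + N) * A ≡ (N + 1) * A + A
    unfold = solve-∀

  expectation : expectedVal1 K N m ≡ divℚ (+ (N + 1)) 2 +ℚ divℚ ((- (+ 1)) ^ s) (2 * D K s)
  expectation = trans (cong (divℚ (+ total)) length-PermsWithKCycles)
    (divℚ-+ (+ total) (+ (N + 1)) ε cycleCount-nonzero (λ ())
      (λ eq → D≢0 (ℕₚ.m*n≡0⇒m≡0 (D K s) 2 (trans (ℕₚ.*-comm (D K s) 2) eq))) (begin
      + total *ᶻ + (2 * (2 * d))
        ≡⟨ cong (+ total *ᶻ_) (trans (ℤₚ.pos-* 2 (2 * d)) (cong (+ 2 *ᶻ_) (ℤₚ.pos-* 2 d))) ⟩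
      + total *ᶻ (+ 2 *ᶻ (+ 2 *ᶻ + d))
        ≡⟨ regroup (+ total) (+ 2) (+ d) ⟩
      (+ 2 *ᶻ + total) *ᶻ (+ 2 *ᶻ + d)
        ≡⟨ cong (_*ᶻ (+ 2 *ᶻ + d)) twice-total ⟩
      (+ (N + 1) *ᶻ + A +ᶻ excess n m) *ᶻ (+ 2 *ᶻ + d)
        ≡⟨ expand (+ (N + 1)) (+ A) (excess n m) (+ 2) (+ d) ⟩
      + (N + 1) *ᶻ (+ 2 *ᶻ + d) *ᶻ + A +ᶻ + 2 *ᶻ (excess n m *ᶻ + d)
        ≡⟨ cong (λ x → + (N + 1) *ᶻ (+ 2 *ᶻ + d) *ᶻ + A +ᶻ + 2 *ᶻ x) excess-ratio ⟩
      + (N + 1) *ᶻ (+ 2 *ᶻ + d) *ᶻ + A +ᶻ + 2 *ᶻ (ε *ᶻ + A)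
        ≡⟨ collect (+ (N + 1)) (+ 2) (+ d) (+ A) ε ⟩
      (+ (N + 1) *ᶻ (+ 2 *ᶻ + d) +ᶻ ε *ᶻ + 2) *ᶻ + A
        ≡⟨ cong (λ x → (+ (N + 1) *ᶻ x +ᶻ ε *ᶻ + 2) *ᶻ + A) (ℤₚ.pos-* 2 d) ⟨
      (+ (N + 1) *ᶻ + (2 * d) +ᶻ ε *ᶻ + 2) *ᶻ + A ∎))
    where
    open ≡-Reasoning
    ε : ℤ
    ε = (- (+ 1)) ^ s
    d : ℕ
    d = D K s
    regroup : ∀ t c d → t *ᶻ (c *ᶻ (c *ᶻ d)) ≡ (c *ᶻ t) *ᶻ (c *ᶻ d)
    regroup = solveℤ
    expand : ∀ x a u c d → (x *ᶻ a +ᶻ u) *ᶻ (c *ᶻ d) ≡ x *ᶻ (c *ᶻ d) *ᶻ a +ᶻ c *ᶻ (u *ᶻ d)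
    expand = solveℤ
    collect : ∀ x c d a e → x *ᶻ (c *ᶻ d) *ᶻ a +ᶻ c *ᶻ (e *ᶻ a) ≡ (x *ᶻ (c *ᶻ d) +ᶻ e *ᶻ c) *ᶻ a
    collect = solveℤ

theorem3p8 : (k n m : ℕ) → k > 1 → 1 ≤ n → m ≤ n →
    (0 < length (PermsWithKCycles k (k * n) m)) ×
    (expectedVal1 k (k * n) m
    ≡ divℚ (+ (k * n + 1)) 2 +ℚ divℚ ((- (+ 1)) ^ (n ∸ m)) (2 * D k (n ∸ m)))
theorem3p8 (suc zero)    n       m (s≤s ()) 1≤n m≤n
theorem3p8 (suc (suc k)) (suc r) m k>1      1≤n m≤n = subst
  (λ N → (0 < length (PermsWithKCycles (suc (suc k)) N m)) ×
    (expectedVal1 (suc (suc k)) N m ≡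
      divℚ (+ (N + 1)) 2 +ℚ divℚ ((- (+ 1)) ^ (suc r ∸ m)) (2 * D (suc (suc k)) (suc r ∸ m))))
  (ℕₚ.*-comm (suc r) (suc (suc k)))
  (subst (0 <_) (sym (length-PermsWithKCycles k r m m≤n)) (ℕₚ.n≢0⇒n>0 (cycleCount-nonzero k r m m≤n)) ,
   expectation k r m m≤n)
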